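{- There exists an algorithm that, given a nondegenerate diagonal integral quadratic form $q=d_1y_1^2+\cdots+d_my_m^2$, computes all maximal orders of the rational Clifford algebra $\operatorname{Clf}(\mathbb{Q}^m,q)$ containing the Clifford order $\operatorname{Clf}(\mathbb{Z}^m,q)$.
   Context: $\operatorname{Clf}(W,q)=T(W)/\langle v\otimes v+q(v)\rangle$. The Clifford order $\operatorname{Clf}(\mathbb{Z}^m,q)$ is the $\mathbb{Z}$-span of the products $\gamma_{s_1}\cdots\gamma_{s_r}$ ($s_1<\dots<s_r$) of the standard generators inside $\operatorname{Clf}(\mathbb{Q}^m,q)$. An order in a finite-dimensional semisimple $\mathbb{Q}$-algebra $A$ is a subring that is a finitely generated $\mathbb{Z}$-module and spans $A$ over $\mathbb{Q}$; it is maximal if it is not properly contained in another order. -}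

module Defs where

open import Data.Nat using (ℕ; zero; suc)
open import Data.Bool using (Bool; true; false; _∧_; _xor_; if_then_else_)
import Data.Bool.Properties as BoolP
open import Data.Integer as ℤ using (ℤ; +_)
open import Data.Rational as ℚ using (ℚ; 0ℚ; 1ℚ)
open import Data.Fin using (Fin)
open import Data.Fin.Subset using (Subset)
open import Data.Vec using (Vec; []; _∷_; head; tail)
import Data.Vec.Properties as VecP
open import Data.List using (List; []; _∷_; _++_; map; concatMap)
open import Data.List.Membership.Propositional using (_∈_)
open import Data.List.Relation.Unary.Any using (Any)
open import Data.Product using (Σ; ∃; _×_; _,_)
open import Relation.Binary.PropositionalEquality using (_≡_)
open import Relation.Nullary using (¬_; yes; no)

-- The rational Clifford algebra Clf(ℚ^m, q), q = d₁y₁² + ⋯ + d_my_m²,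
-- modelled on its standard ℚ-basis γ_S = γ_{s₁}⋯γ_{s_r} (s₁<⋯<s_r),
-- indexed by subsets S ⊆ {0,…,m-1}.  Relations: γ_i² = -q(e_i) = -d_i,
-- γ_i γ_j = -γ_j γ_i (i ≠ j).  Index 0 is the head of the vector.

card : ∀ {m} → Subset m → ℕ
card [] = 0
card (true ∷ S) = suc (card S)
card (false ∷ S) = card S

sgn : ℕ → ℤ
sgn zero = + 1
sgn (suc n) = ℤ.- sgn n

-- γ_S · γ_T = c · γ_U ; basisMul d S T = (c , U).
-- With S = γ₀^b γ_{S'}, T = γ₀^c γ_{T'}:
-- γ_S γ_T = (-1)^{c·|S'|} γ₀^b γ₀^c γ_{S'} γ_{T'}, and γ₀γ₀ = -d₀.
basisMul : ∀ {m} → Vec ℤ m → Subset m → Subset m → ℤ × Subset m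
basisMul [] [] [] = (+ 1 , [])
basisMul (d₀ ∷ d) (b ∷ S) (c ∷ T) with basisMul d S T
... | (k , U) =
  ( (if c then sgn (card S) else + 1) ℤ.* ((if b ∧ c then ℤ.- d₀ else + 1) ℤ.* k)
  , (b xor c) ∷ U )

allSubsets : (m : ℕ) → List (Subset m)
allSubsets zero = [] ∷ []
allSubsets (suc m) = map (true ∷_) (allSubsets m) ++ map (false ∷_) (allSubsets m)

sumList : List ℚ → ℚ
sumList [] = 0ℚ
sumList (x ∷ xs) = x ℚ.+ sumList xs

ι : ℤ → ℚ
ι k = k ℚ./ 1

Clf : ℕ → Set
Clf m = Subset m → ℚ

module _ {m : ℕ} where

  _≈_ : Clf m → Clf m → Set
  x ≈ y = ∀ S → x S ≡ y S

  0C : Clf m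
  0C _ = 0ℚ

  1C : Clf m
  1C S with VecP.≡-dec BoolP._≟_ S (Data.Vec.replicate m false)
  ... | yes _ = 1ℚ
  ... | no _ = 0ℚ

  _+C_ : Clf m → Clf m → Clf m
  (x +C y) S = x S ℚ.+ y S

  -C_ : Clf m → Clf m
  (-C x) S = ℚ.- (x S)

  _·C_ : ℚ → Clf m → Clf m
  (r ·C x) S = r ℚ.* x S

  mulC : Vec ℤ m → Clf m → Clf m → Clf m
  mulC d x y U =
    sumList (concatMap (λ S → map (λ T → term S T) (allSubsets m)) (allSubsets m))
    where
    term : Subset m → Subset m → ℚ
    term S T with basisMul d S T
    ... | (k , V) with VecP.≡-dec BoolP._≟_ V U
    ...   | yes _ = ι k ℚ.* (x S ℚ.* y T)
    ...   | no _ = 0ℚ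

  sumC : (k : ℕ) → (Fin k → Clf m) → Clf m
  sumC zero f = 0C
  sumC (suc k) f = f Fin.zero +C sumC k (λ i → f (Fin.suc i))
    where import Data.Fin as Fin

  Pred : Set₁
  Pred = Clf m → Set

  _⊆_ : Pred → Pred → Set
  O ⊆ O' = ∀ x → O x → O' x

  _≐_ : Pred → Pred → Set
  O ≐ O' = (O ⊆ O') × (O' ⊆ O)

  Gens : Set
  Gens = Σ ℕ λ k → Fin k → Clf m

  ZSpan : Gens → Pred
  ZSpan (k , g) x = Σ (Fin k → ℤ) λ c → x ≈ sumC k (λ i → ι (c i) ·C g i)

  record IsOrder (d : Vec ℤ m) (O : Pred) : Set where
    field
      one  : O 1C
      add  : ∀ x y → O x → O y → O (x +C y)
      neg  : ∀ x → O x → O (-C x)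
      mul  : ∀ x y → O x → O y → O (mulC d x y)
      finGen : Σ Gens λ G → O ≐ ZSpan G
      spans : ∀ x → Σ ℕ λ k → Σ (Fin k → Clf m) λ v → (∀ i → O (v i)) ×
                Σ (Fin k → ℚ) λ r → x ≈ sumC k (λ i → r i ·C v i)

  IsMaximalOrder : Vec ℤ m → Pred → Set₁
  IsMaximalOrder d O = IsOrder d O × (∀ O' → IsOrder d O' → O ⊆ O' → O' ⊆ O)

  -- the Clifford order Clf(ℤ^m,q): ℤ-span of the basis products γ_S
  CliffordOrder : Pred
  CliffordOrder x = ∀ S → Σ ℤ λ k → x S ≡ ι k

Nondegenerate : ∀ {m} → Vec ℤ m → Set
Nondegenerate {m} d = (i : Fin m) → ¬ (Data.Vec.lookup d i ≡ + 0)

{-# OPTIONS --safe #-}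
module Submission where

-- Every order O ⊇ Λ = Clf(ℤ^m, q) satisfies N·O ⊆ Λ for an N depending only on q. For x ∈ O and a
-- basis element γ_S, average z = x γ_S over the maps z ↦ dᵢ z - γᵢ z γᵢ: the result stays in O and
-- keeps, up to the factor P₀ = ∏ 2dᵢ, only the components of 1 and (for odd m) of the central element
-- γ_full. It therefore lives in a commutative algebra ℚ[ω], ω² ∈ ℤ, and its powers have bounded
-- denominators because O is a finitely generated ℤ-module; so its trace 2 P₀ γ_S² x_S is an integer.
-- Consequently each such O is Λ + Σ_{r ∈ B} ℤ·r/N for a set B of residue vectors mod N. There are
-- finitely many such B, and membership, closure under products and inclusion are decidable for them
-- by a finite search, so the maximal orders are found by comparing all candidates.

open import Defs
open import Level using (0ℓ)
open import Function using (_∘_)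
open import Data.Empty using (⊥-elim)
open import Data.Bool using (true; false; _xor_)
import Data.Bool.Properties as BoolP
open import Data.Nat as ℕ using (ℕ; zero; suc; _≤_; _<_; z≤n; s≤s)
import Data.Nat.Properties as ℕP
open import Data.Nat.Divisibility using (_∣_; divides; ∣-trans; ∣⇒≤)
import Data.Nat.Coprimality as Coprimality
open Coprimality using (Coprime; coprime-divisor)
open import Data.Nat.ListAction using (product)
open import Data.Nat.ListAction.Properties using (∈⇒∣product; product≢0)
open import Data.Integer as ℤ using (ℤ; +_; -[1+_])
import Data.Integer.Properties as ℤP
open import Data.Integer.DivMod using (_/ℕ_; n%ℕd<d; a≡a%ℕn+[a/ℕn]*n)
open import Data.Integer.Tactic.RingSolver using () renaming (solve-∀ to solveℤ)
open import Data.Rational as ℚ using (ℚ; mkℚ; 0ℚ; 1ℚ; _+_; _*_; -_; toℚᵘ; ↥_; ↧_; ↧ₙ_)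
import Data.Rational.Properties as ℚP
import Data.Rational.Unnormalised as ℚᵘ
import Data.Rational.Unnormalised.Properties as ℚᵘP
open import Algebra.Definitions.RawSemiring ℚ.+-*-rawSemiring using (_^_)
open import Algebra.Properties.CommutativeSemigroup ℕP.*-commutativeSemigroup using (x∙yz≈y∙xz)
open import Data.Vec as Vec using (Vec; []; _∷_; lookup; zipWith; tabulate)
import Data.Vec.Properties as VecP
open import Data.Fin as Fin using (Fin; zero; suc; toℕ; fromℕ<; splitAt; _↑ˡ_; _↑ʳ_)
import Data.Fin.Properties as FinP
open import Data.Fin.Subset using (Subset; ⁅_⁆) renaming (⊥ to ∅; ⊤ to full)
open import Data.List as List using (List; []; _∷_; _++_; map; concatMap; filter; length; allFin)
import Data.List.Properties as ListP
open import Data.List.Membership.Propositional using (_∈_)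
open import Data.List.Membership.Propositional.Properties
  using (∈-map⁺; ∈-map⁻; ∈-++⁺ˡ; ∈-++⁺ʳ; ∈-concatMap⁺; ∈-allFin; ∈-filter⁺; ∈-filter⁻; ∈-lookup)
open import Data.List.Relation.Unary.Any as Any using (Any; here; there)
import Data.List.Relation.Unary.Any.Properties as AnyP
open import Data.List.Relation.Unary.All as All using (All)
import Data.List.Relation.Unary.All.Properties as AllP
open import Data.Product using (Σ; ∃; _×_; _,_; proj₁; proj₂)
open import Data.Sum using (_⊎_; inj₁; inj₂; [_,_]′)
open import Relation.Nullary using (Dec; yes; no; does; ¬_; contradiction)
import Relation.Nullary.Decidable as Dec
open import Relation.Nullary.Decidable using (_×-dec_; _→-dec_)
import Relation.Nullary.Decidable.Core as DecCore
open import Relation.Unary using (Decidable)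
open import Relation.Binary.Definitions using (DecidableEquality)
open import Relation.Binary.PropositionalEquality
open import Tactic.RingSolver using (solve-∀)
import Tactic.RingSolver.Core.AlmostCommutativeRing as ACR

ringℚ : ACR.AlmostCommutativeRing 0ℓ 0ℓ
ringℚ = ACR.fromCommutativeRing ℚP.+-*-commutativeRing (λ x → DecCore.dec⇒maybe (0ℚ ℚP.≟ x))

-- Integers inside ℚ
toℚᵘ-ι : ∀ k → toℚᵘ (ι k) ℚᵘ.≃ ℚᵘ.mkℚᵘ k 0
toℚᵘ-ι k = ℚP.toℚᵘ-fromℚᵘ (ℚᵘ.mkℚᵘ k 0)

ι-homo-+ : ∀ a b → ι (a ℤ.+ b) ≡ ι a + ι b
ι-homo-+ a b = ℚP.toℚᵘ-injective (begin
  toℚᵘ (ι (a ℤ.+ b))                        ≈⟨ toℚᵘ-ι (a ℤ.+ b) ⟩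
  ℚᵘ.mkℚᵘ (a ℤ.+ b) 0                        ≈⟨ ℚᵘ.*≡* (cross-multiplied a b) ⟩
  ℚᵘ.mkℚᵘ a 0 ℚᵘ.+ ℚᵘ.mkℚᵘ b 0               ≈⟨ ℚᵘP.+-cong (toℚᵘ-ι a) (toℚᵘ-ι b) ⟨
  toℚᵘ (ι a) ℚᵘ.+ toℚᵘ (ι b)                 ≈⟨ ℚP.toℚᵘ-homo-+ (ι a) (ι b) ⟨
  toℚᵘ (ι a + ι b)                           ∎)
  where
  open ℚᵘP.≃-Reasoning
  cross-multiplied : ∀ a b → (a ℤ.+ b) ℤ.* + 1 ≡ (a ℤ.* + 1 ℤ.+ b ℤ.* + 1) ℤ.* + 1
  cross-multiplied = solveℤ

ι-homo-* : ∀ a b → ι (a ℤ.* b) ≡ ι a * ι b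
ι-homo-* a b = ℚP.toℚᵘ-injective (begin
  toℚᵘ (ι (a ℤ.* b))                        ≈⟨ toℚᵘ-ι (a ℤ.* b) ⟩
  ℚᵘ.mkℚᵘ a 0 ℚᵘ.* ℚᵘ.mkℚᵘ b 0               ≈⟨ ℚᵘP.*-cong (toℚᵘ-ι a) (toℚᵘ-ι b) ⟨
  toℚᵘ (ι a) ℚᵘ.* toℚᵘ (ι b)                 ≈⟨ ℚP.toℚᵘ-homo-* (ι a) (ι b) ⟨
  toℚᵘ (ι a * ι b)                           ∎)
  where open ℚᵘP.≃-Reasoning

ι-homo‿- : ∀ a → ι (ℤ.- a) ≡ - ι a
ι-homo‿- a = ℚP.toℚᵘ-injective (begin
  toℚᵘ (ι (ℤ.- a))                          ≈⟨ toℚᵘ-ι (ℤ.- a) ⟩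
  ℚᵘ.- ℚᵘ.mkℚᵘ a 0                           ≈⟨ ℚᵘP.-‿cong (toℚᵘ-ι a) ⟨
  ℚᵘ.- toℚᵘ (ι a)                            ≈⟨ ℚP.toℚᵘ-homo‿- (ι a) ⟨
  toℚᵘ (- ι a)                               ∎)
  where open ℚᵘP.≃-Reasoning

ι-injective : ∀ {a b} → ι a ≡ ι b → a ≡ b
ι-injective {a} {b} eq with ℚᵘP.≃-trans (ℚᵘP.≃-sym (toℚᵘ-ι a)) (ℚᵘP.≃-trans (ℚP.toℚᵘ-cong eq) (toℚᵘ-ι b))
... | ℚᵘ.*≡* e = trans (sym (ℤP.*-identityʳ a)) (trans e (ℤP.*-identityʳ b))

q*↧q≡↥q : ∀ q → q * ι (+ ↧ₙ q) ≡ ι (↥ q)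
q*↧q≡↥q q@(mkℚ n d-1 _) = ℚP.toℚᵘ-injective (begin
  toℚᵘ (q * ι (+ suc d-1))                   ≈⟨ ℚP.toℚᵘ-homo-* q (ι (+ suc d-1)) ⟩
  toℚᵘ q ℚᵘ.* toℚᵘ (ι (+ suc d-1))           ≈⟨ ℚᵘP.*-congˡ {toℚᵘ q} (toℚᵘ-ι (+ suc d-1)) ⟩
  toℚᵘ q ℚᵘ.* ℚᵘ.mkℚᵘ (+ suc d-1) 0          ≈⟨ ℚᵘ.*≡* (trans (ℤP.*-identityʳ (n ℤ.* + suc d-1)) (cong (λ e → n ℤ.* + suc e) (sym (ℕP.*-identityʳ d-1)))) ⟩
  ℚᵘ.mkℚᵘ n 0                                ≈⟨ toℚᵘ-ι n ⟨
  toℚᵘ (ι n)                                 ∎)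
  where open ℚᵘP.≃-Reasoning

IsInteger : ℚ → Set
IsInteger q = Σ ℤ λ k → q ≡ ι k

isInteger-+ : ∀ {p q} → IsInteger p → IsInteger q → IsInteger (p + q)
isInteger-+ (a , refl) (b , refl) = a ℤ.+ b , sym (ι-homo-+ a b)

isInteger-* : ∀ {p q} → IsInteger p → IsInteger q → IsInteger (p * q)
isInteger-* (a , refl) (b , refl) = a ℤ.* b , sym (ι-homo-* a b)

isInteger-‿ : ∀ {p} → IsInteger p → IsInteger (- p)
isInteger-‿ (a , refl) = ℤ.- a , sym (ι-homo‿- a)

isInteger-resp : ∀ {p q} → p ≡ q → IsInteger p → IsInteger q
isInteger-resp refl i = i

↧ₙι≡1 : ∀ k → ↧ₙ (ι k) ≡ 1
↧ₙι≡1 k = ℤP.+-injective (trans (sym (ℤP.*-identityʳ (↧ (ι k))))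
  (trans (cong (↧ (ι k) ℤ.*_) gcd[k,1]≡1) (ℚP.↧-/ k 1)))
  where
  import Data.Integer.GCD as ℤGCD
  gcd[k,1]≡1 : + 1 ≡ ℤGCD.gcd k (+ 1)
  gcd[k,1]≡1 = cong +_ (sym (Coprimality.coprime⇒gcd≡1 (Coprimality.sym (Coprimality.1-coprimeTo ℤ.∣ k ∣))))

isInteger? : ∀ q → Dec (IsInteger q)
isInteger? q with ↧ₙ q ℕ.≟ 1
... | yes ↧q≡1 = yes (↥ q , trans (sym (ℚP.↥p/↧p≡p q)) (ℚP./-cong {p₁ = ↥ q} refl ↧q≡1))
... | no ↧q≢1 = no λ { (k , refl) → ↧q≢1 (↧ₙι≡1 k) }

private
  coprime-*ˡ : ∀ {a b c} → Coprime a c → Coprime b c → Coprime (a ℕ.* b) c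
  coprime-*ˡ a⊥c b⊥c (i∣ab , i∣c) =
    b⊥c (coprime-divisor (λ (j∣i , j∣a) → a⊥c (j∣a , ∣-trans j∣i i∣c)) i∣ab , i∣c)

  coprime-^ˡ : ∀ {a c} → Coprime a c → ∀ k → Coprime (a ℕ.^ k) c
  coprime-^ˡ a⊥c zero = Coprimality.1-coprimeTo _
  coprime-^ˡ a⊥c (suc k) = coprime-*ˡ a⊥c (coprime-^ˡ a⊥c k)

  coprime-divisor-^ : ∀ {q p D} → Coprime q p → ∀ j → q ∣ D ℕ.* p ℕ.^ j → q ∣ D
  coprime-divisor-^ {q} {p} {D} q⊥p zero q∣D*1 = subst (q ∣_) (ℕP.*-identityʳ D) q∣D*1
  coprime-divisor-^ {q} {p} {D} q⊥p (suc j) q∣D*p^[1+j] =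
    coprime-divisor-^ q⊥p j (coprime-divisor q⊥p (subst (q ∣_) (x∙yz≈y∙xz D p (p ℕ.^ j)) q∣D*p^[1+j]))

  ↧⊥↥ : ∀ r → Coprime (↧ₙ r) ℤ.∣ ↥ r ∣
  ↧⊥↥ (mkℚ _ _ ↥⊥↧) = Coprimality.sym (Coprimality.recompute ↥⊥↧)

  ∣i^n∣≡∣i∣^n : ∀ i n → ℤ.∣ i ℤ.^ n ∣ ≡ ℤ.∣ i ∣ ℕ.^ n
  ∣i^n∣≡∣i∣^n i zero = refl
  ∣i^n∣≡∣i∣^n i (suc n) = trans (ℤP.abs-* i (i ℤ.^ n)) (cong (ℤ.∣ i ∣ ℕ.*_) (∣i^n∣≡∣i∣^n i n))

  n<m^n : ∀ {m} n → 2 ≤ m → n < m ℕ.^ n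
  n<m^n zero 2≤m = s≤s z≤n
  n<m^n {m} (suc n) 2≤m = begin-strict
    suc n                      ≤⟨ n<m^n n 2≤m ⟩
    m ℕ.^ n                    <⟨ ℕP.m<m+n (m ℕ.^ n) (ℕP.m^n>0 m {{ℕ.>-nonZero (ℕP.≤-trans (s≤s z≤n) 2≤m)}} n) ⟩
    m ℕ.^ n ℕ.+ m ℕ.^ n        ≡⟨ cong (m ℕ.^ n ℕ.+_) (ℕP.+-identityʳ (m ℕ.^ n)) ⟨
    2 ℕ.* m ℕ.^ n              ≤⟨ ℕP.*-monoˡ-≤ (m ℕ.^ n) 2≤m ⟩
    m ℕ.^ suc n                ∎
    where open ℕP.≤-Reasoning

↥↧-^ : ∀ r k → r ^ k * ι ((+ ↧ₙ r) ℤ.^ k) ≡ ι (↥ r ℤ.^ k)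
↥↧-^ r zero = refl
↥↧-^ r (suc k) = begin
  (r * r ^ k) * ι (+ ↧ₙ r ℤ.* (+ ↧ₙ r) ℤ.^ k)      ≡⟨ cong ((r * r ^ k) *_) (ι-homo-* (+ ↧ₙ r) ((+ ↧ₙ r) ℤ.^ k)) ⟩
  (r * r ^ k) * (ι (+ ↧ₙ r) * ι ((+ ↧ₙ r) ℤ.^ k))  ≡⟨ interchange r (r ^ k) (ι (+ ↧ₙ r)) (ι ((+ ↧ₙ r) ℤ.^ k)) ⟩
  (r * ι (+ ↧ₙ r)) * (r ^ k * ι ((+ ↧ₙ r) ℤ.^ k))  ≡⟨ cong₂ _*_ (q*↧q≡↥q r) (↥↧-^ r k) ⟩
  ι (↥ r) * ι (↥ r ℤ.^ k)                          ≡⟨ ι-homo-* (↥ r) (↥ r ℤ.^ k) ⟨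
  ι (↥ r ℤ.^ suc k)                                ∎
  where
  open ≡-Reasoning
  interchange : ∀ a b c e → (a * b) * (c * e) ≡ (a * c) * (b * e)
  interchange = solve-∀ ringℚ

-- With r = P/Q in lowest terms, D·r^D ∈ ℤ gives Q^D ∣ D, which forces Q = 1.
bounded-powers⇒isInteger : ∀ D .{{_ : ℕ.NonZero D}} → ∀ r → (∀ k → IsInteger (ι (+ D) * r ^ k)) → IsInteger r
bounded-powers⇒isInteger D r D*r^k∈ℤ with ↧ₙ r ℕ.≟ 1
... | yes Q≡1 = ↥ r , trans (sym (ℚP.*-identityʳ r)) (trans (cong (λ Q → r * ι (+ Q)) (sym Q≡1)) (q*↧q≡↥q r))
... | no Q≢1 = ⊥-elim (ℕP.<⇒≱ (n<m^n D 2≤Q) (∣⇒≤ Q^D∣D))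
  where
  Q = ↧ₙ r
  P = ↥ r
  z = proj₁ (D*r^k∈ℤ D)

  2≤Q : 2 ≤ Q
  2≤Q = ℕP.≤∧≢⇒< (s≤s z≤n) (λ 1≡Q → Q≢1 (sym 1≡Q))

  Q⊥P : Coprime Q ℤ.∣ P ∣
  Q⊥P = ↧⊥↥ r

  D*P^D≡z*Q^D : + D ℤ.* P ℤ.^ D ≡ z ℤ.* (+ Q) ℤ.^ D
  D*P^D≡z*Q^D = ι-injective (begin
    ι (+ D ℤ.* P ℤ.^ D)                   ≡⟨ ι-homo-* (+ D) (P ℤ.^ D) ⟩
    ι (+ D) * ι (P ℤ.^ D)                 ≡⟨ cong (ι (+ D) *_) (↥↧-^ r D) ⟨
    ι (+ D) * (r ^ D * ι ((+ Q) ℤ.^ D))   ≡⟨ ℚP.*-assoc (ι (+ D)) (r ^ D) (ι ((+ Q) ℤ.^ D)) ⟨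
    (ι (+ D) * r ^ D) * ι ((+ Q) ℤ.^ D)   ≡⟨ cong (_* ι ((+ Q) ℤ.^ D)) (proj₂ (D*r^k∈ℤ D)) ⟩
    ι z * ι ((+ Q) ℤ.^ D)                 ≡⟨ ι-homo-* z ((+ Q) ℤ.^ D) ⟨
    ι (z ℤ.* (+ Q) ℤ.^ D)                 ∎)
    where open ≡-Reasoning

  Q^D∣D : Q ℕ.^ D ∣ D
  Q^D∣D = coprime-divisor-^ (coprime-^ˡ Q⊥P D) D (divides ℤ.∣ z ∣ (begin
    D ℕ.* ℤ.∣ P ∣ ℕ.^ D            ≡⟨ cong (D ℕ.*_) (∣i^n∣≡∣i∣^n P D) ⟨
    D ℕ.* ℤ.∣ P ℤ.^ D ∣            ≡⟨ ℤP.abs-* (+ D) (P ℤ.^ D) ⟨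
    ℤ.∣ + D ℤ.* P ℤ.^ D ∣          ≡⟨ cong ℤ.∣_∣ D*P^D≡z*Q^D ⟩
    ℤ.∣ z ℤ.* (+ Q) ℤ.^ D ∣        ≡⟨ ℤP.abs-* z ((+ Q) ℤ.^ D) ⟩
    ℤ.∣ z ∣ ℕ.* ℤ.∣ (+ Q) ℤ.^ D ∣  ≡⟨ cong (ℤ.∣ z ∣ ℕ.*_) (∣i^n∣≡∣i∣^n (+ Q) D) ⟩
    ℤ.∣ z ∣ ℕ.* Q ℕ.^ D            ∎))
    where open ≡-Reasoning

-- Subsets and sums over them
_≟ˢ_ : ∀ {m} → DecidableEquality (Subset m)
_≟ˢ_ = VecP.≡-dec BoolP._≟_

infixl 6 _⊕_
_⊕_ : ∀ {m} → Subset m → Subset m → Subset m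
_⊕_ = zipWith _xor_

module _ {m : ℕ} where

  ⊕-comm : (S T : Subset m) → S ⊕ T ≡ T ⊕ S
  ⊕-comm = VecP.zipWith-comm BoolP.xor-comm

  ⊕-assoc : (S T U : Subset m) → (S ⊕ T) ⊕ U ≡ S ⊕ (T ⊕ U)
  ⊕-assoc = VecP.zipWith-assoc BoolP.xor-assoc

  ⊕-identityˡ : (S : Subset m) → ∅ ⊕ S ≡ S
  ⊕-identityˡ = VecP.zipWith-identityˡ BoolP.xor-identityˡ

  ⊕-identityʳ : (S : Subset m) → S ⊕ ∅ ≡ S
  ⊕-identityʳ = VecP.zipWith-identityʳ BoolP.xor-identityʳ

⊕-self : ∀ {m} (S : Subset m) → S ⊕ S ≡ ∅
⊕-self [] = refl
⊕-self (b ∷ S) = cong₂ _∷_ (BoolP.xor-same b) (⊕-self S)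

⊕-cancelˡ : ∀ {m} (S U : Subset m) → S ⊕ (S ⊕ U) ≡ U
⊕-cancelˡ S U = trans (sym (⊕-assoc S S U)) (trans (cong (_⊕ U) (⊕-self S)) (⊕-identityˡ U))

⊕-cancelʳ : ∀ {m} (U S : Subset m) → (U ⊕ S) ⊕ S ≡ U
⊕-cancelʳ U S = trans (⊕-assoc U S S) (trans (cong (U ⊕_) (⊕-self S)) (⊕-identityʳ U))

when : ∀ {P : Set} → Dec P → ℚ → ℚ
when (yes _) a = a
when (no _) _ = 0ℚ

when-yes : ∀ {P : Set} (P? : Dec P) a → P → when P? a ≡ a
when-yes (yes _) a _ = refl
when-yes (no ¬p) a p = contradiction p ¬p

when-no : ∀ {P : Set} (P? : Dec P) a → ¬ P → when P? a ≡ 0ℚ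
when-no (yes p) a ¬p = contradiction p ¬p
when-no (no _) a _ = refl

∑ₗ : ∀ {A : Set} → List A → (A → ℚ) → ℚ
∑ₗ xs f = sumList (map f xs)

sumList-++ : (ps qs : List ℚ) → sumList (ps ++ qs) ≡ sumList ps + sumList qs
sumList-++ [] qs = sym (ℚP.+-identityˡ _)
sumList-++ (p ∷ ps) qs = trans (cong (_+_ p) (sumList-++ ps qs)) (sym (ℚP.+-assoc p _ _))

module _ {A : Set} where

  ∑ₗ-++ : ∀ xs ys (f : A → ℚ) → ∑ₗ (xs ++ ys) f ≡ ∑ₗ xs f + ∑ₗ ys f
  ∑ₗ-++ xs ys f = trans (cong sumList (ListP.map-++ f xs ys)) (sumList-++ (map f xs) (map f ys))

  ∑ₗ-cong : ∀ xs {f g : A → ℚ} → (∀ a → f a ≡ g a) → ∑ₗ xs f ≡ ∑ₗ xs g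
  ∑ₗ-cong [] f≗g = refl
  ∑ₗ-cong (x ∷ xs) f≗g = cong₂ _+_ (f≗g x) (∑ₗ-cong xs f≗g)

  ∑ₗ-+ : ∀ xs (f g : A → ℚ) → ∑ₗ xs (λ a → f a + g a) ≡ ∑ₗ xs f + ∑ₗ xs g
  ∑ₗ-+ [] f g = refl
  ∑ₗ-+ (x ∷ xs) f g = trans (cong (_+_ (f x + g x)) (∑ₗ-+ xs f g)) (interchange (f x) (g x) _ _)
    where
    interchange : ∀ a b c e → (a + b) + (c + e) ≡ (a + c) + (b + e)
    interchange = solve-∀ ringℚ

  ∑ₗ-*ˡ : ∀ xs c (f : A → ℚ) → ∑ₗ xs (λ a → c * f a) ≡ c * ∑ₗ xs f
  ∑ₗ-*ˡ [] c f = sym (ℚP.*-zeroʳ c)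
  ∑ₗ-*ˡ (x ∷ xs) c f = trans (cong (_+_ (c * f x)) (∑ₗ-*ˡ xs c f)) (sym (ℚP.*-distribˡ-+ c (f x) _))

  ∑ₗ-0 : ∀ xs (f : A → ℚ) → (∀ a → f a ≡ 0ℚ) → ∑ₗ xs f ≡ 0ℚ
  ∑ₗ-0 [] f f≗0 = refl
  ∑ₗ-0 (x ∷ xs) f f≗0 = trans (cong₂ _+_ (f≗0 x) (∑ₗ-0 xs f f≗0)) (ℚP.+-identityˡ 0ℚ)

  ∑ₗ-map : ∀ {B : Set} xs (g : A → B) (f : B → ℚ) → ∑ₗ (map g xs) f ≡ ∑ₗ xs (λ a → f (g a))
  ∑ₗ-map [] g f = refl
  ∑ₗ-map (x ∷ xs) g f = cong (_+_ (f (g x))) (∑ₗ-map xs g f)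

  ∑ₗ-concatMap : ∀ {B : Set} xs (ys : List B) (t : A → B → ℚ) →
    sumList (concatMap (λ a → map (t a) ys) xs) ≡ ∑ₗ xs (λ a → ∑ₗ ys (t a))
  ∑ₗ-concatMap [] ys t = refl
  ∑ₗ-concatMap (x ∷ xs) ys t =
    trans (sumList-++ (map (t x) ys) _) (cong (_+_ (∑ₗ ys (t x))) (∑ₗ-concatMap xs ys t))

∑ : ∀ {m} → (Subset m → ℚ) → ℚ
∑ {m} = ∑ₗ (allSubsets m)

module _ {m : ℕ} where

  ∑-cong : {f g : Subset m → ℚ} → (∀ S → f S ≡ g S) → ∑ f ≡ ∑ g
  ∑-cong = ∑ₗ-cong (allSubsets m)

  ∑-+ : (f g : Subset m → ℚ) → ∑ (λ S → f S + g S) ≡ ∑ f + ∑ g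
  ∑-+ = ∑ₗ-+ (allSubsets m)

  ∑-*ˡ : ∀ c (f : Subset m → ℚ) → ∑ (λ S → c * f S) ≡ c * ∑ f
  ∑-*ˡ = ∑ₗ-*ˡ (allSubsets m)

  ∑-0 : (f : Subset m → ℚ) → (∀ S → f S ≡ 0ℚ) → ∑ f ≡ 0ℚ
  ∑-0 = ∑ₗ-0 (allSubsets m)

∑-suc : ∀ {m} (f : Subset (suc m) → ℚ) → ∑ f ≡ ∑ (λ S → f (true ∷ S)) + ∑ (λ S → f (false ∷ S))
∑-suc {m} f = trans (∑ₗ-++ (map (true ∷_) (allSubsets m)) _ f)
  (cong₂ _+_ (∑ₗ-map (allSubsets m) (true ∷_) f) (∑ₗ-map (allSubsets m) (false ∷_) f))

∑-single : ∀ {m} (f : Subset m → ℚ) S₀ → (∀ S → S ≢ S₀ → f S ≡ 0ℚ) → ∑ f ≡ f S₀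
∑-single {zero} f [] _ = ℚP.+-identityʳ (f [])
∑-single {suc m} f (true ∷ S₀) f≗0 = trans (∑-suc f) (trans
  (cong₂ _+_ (∑-single (λ S → f (true ∷ S)) S₀ (λ S S≢S₀ → f≗0 (true ∷ S) (λ eq → S≢S₀ (VecP.∷-injectiveʳ eq))))
             (∑-0 _ (λ S → f≗0 (false ∷ S) (λ ()))))
  (ℚP.+-identityʳ _))
∑-single {suc m} f (false ∷ S₀) f≗0 = trans (∑-suc f) (trans
  (cong₂ _+_ (∑-0 _ (λ S → f≗0 (true ∷ S) (λ ())))
             (∑-single (λ S → f (false ∷ S)) S₀ (λ S S≢S₀ → f≗0 (false ∷ S) (λ eq → S≢S₀ (VecP.∷-injectiveʳ eq)))))
  (ℚP.+-identityˡ _))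

-- Clifford multiplication in coordinates
basisCoeff : ∀ {m} → Vec ℤ m → Subset m → Subset m → ℤ
basisCoeff d S T = proj₁ (basisMul d S T)

basisMul-subset : ∀ {m} (d : Vec ℤ m) S T → proj₂ (basisMul d S T) ≡ S ⊕ T
basisMul-subset [] [] [] = refl
basisMul-subset (_ ∷ d) (b ∷ S) (c ∷ T) = cong (_ ∷_) (basisMul-subset d S T)

module _ {m : ℕ} (d : Vec ℤ m) where

  private
    summand : (x y : Clf m) (U S T : Subset m) → ℚ
    summand x y U S T = when (proj₂ (basisMul d S T) ≟ˢ U) (ι (basisCoeff d S T) * (x S * y T))

    mutual
      mulC-double-sum : ∀ x y U → mulC d x y U ≡ ∑ λ S → ∑ λ T → summand x y U S T
      mulC-double-sum x y U = trans (∑ₗ-concatMap (allSubsets m) (allSubsets m) _)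
        (∑-cong λ S → ∑-cong λ T → summand-unfold x y U S T)

      -- The left-hand side is the summand of mulC, which is local to its definition and cannot be named.
      summand-unfold : ∀ x y U S T → _ ≡ summand x y U S T
      summand-unfold x y U S T with proj₂ (basisMul d S T) ≟ˢ U
      ... | yes _ = refl
      ... | no _ = refl

  mulTerm : Clf m → Clf m → Subset m → Subset m → ℚ
  mulTerm x y U S = ι (basisCoeff d S (S ⊕ U)) * (x S * y (S ⊕ U))

  mulC-coord : ∀ x y U → mulC d x y U ≡ ∑ (mulTerm x y U)
  mulC-coord x y U = trans (mulC-double-sum x y U) (∑-cong λ S →
    trans (∑-single (summand x y U S) (S ⊕ U) (off-diagonal S))
          (when-yes (_ ≟ˢ U) _ (trans (basisMul-subset d S (S ⊕ U)) (⊕-cancelˡ S U))))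
    where
    off-diagonal : ∀ S T → T ≢ S ⊕ U → summand x y U S T ≡ 0ℚ
    off-diagonal S T T≢S⊕U = when-no (_ ≟ˢ U) _ λ S⊕T≡U →
      T≢S⊕U (trans (sym (⊕-cancelˡ S T)) (cong (S ⊕_) (trans (sym (basisMul-subset d S T)) S⊕T≡U)))

  mulC-cong : ∀ {x x′ y y′} → x ≈ x′ → y ≈ y′ → mulC d x y ≈ mulC d x′ y′
  mulC-cong {x} {x′} {y} {y′} x≈x′ y≈y′ U = trans (mulC-coord x y U) (trans
    (∑-cong λ S → cong₂ (λ a b → ι (basisCoeff d S (S ⊕ U)) * (a * b)) (x≈x′ S) (y≈y′ (S ⊕ U)))
    (sym (mulC-coord x′ y′ U)))

  mulC-+ˡ : ∀ x x′ y U → mulC d (x +C x′) y U ≡ mulC d x y U + mulC d x′ y U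
  mulC-+ˡ x x′ y U = trans (mulC-coord (x +C x′) y U) (trans
    (∑-cong λ S → distrib (ι (basisCoeff d S (S ⊕ U))) (x S) (x′ S) (y (S ⊕ U)))
    (trans (∑-+ (mulTerm x y U) (mulTerm x′ y U)) (sym (cong₂ _+_ (mulC-coord x y U) (mulC-coord x′ y U)))))
    where
    distrib : ∀ k a a′ b → k * ((a + a′) * b) ≡ k * (a * b) + k * (a′ * b)
    distrib = solve-∀ ringℚ

  mulC-+ʳ : ∀ x y y′ U → mulC d x (y +C y′) U ≡ mulC d x y U + mulC d x y′ U
  mulC-+ʳ x y y′ U = trans (mulC-coord x (y +C y′) U) (trans
    (∑-cong λ S → distrib (ι (basisCoeff d S (S ⊕ U))) (x S) (y (S ⊕ U)) (y′ (S ⊕ U)))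
    (trans (∑-+ (mulTerm x y U) (mulTerm x y′ U)) (sym (cong₂ _+_ (mulC-coord x y U) (mulC-coord x y′ U)))))
    where
    distrib : ∀ k a b b′ → k * (a * (b + b′)) ≡ k * (a * b) + k * (a * b′)
    distrib = solve-∀ ringℚ

  mulC-·ˡ : ∀ r x y U → mulC d (r ·C x) y U ≡ r * mulC d x y U
  mulC-·ˡ r x y U = trans (mulC-coord (r ·C x) y U) (trans
    (∑-cong λ S → rearrange (ι (basisCoeff d S (S ⊕ U))) r (x S) (y (S ⊕ U)))
    (trans (∑-*ˡ r (mulTerm x y U)) (cong (r *_) (sym (mulC-coord x y U)))))
    where
    rearrange : ∀ k r a b → k * ((r * a) * b) ≡ r * (k * (a * b))
    rearrange = solve-∀ ringℚ

  mulC-·ʳ : ∀ r x y U → mulC d x (r ·C y) U ≡ r * mulC d x y U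
  mulC-·ʳ r x y U = trans (mulC-coord x (r ·C y) U) (trans
    (∑-cong λ S → rearrange (ι (basisCoeff d S (S ⊕ U))) r (x S) (y (S ⊕ U)))
    (trans (∑-*ˡ r (mulTerm x y U)) (cong (r *_) (sym (mulC-coord x y U)))))
    where
    rearrange : ∀ k r a b → k * (a * (r * b)) ≡ r * (k * (a * b))
    rearrange = solve-∀ ringℚ

  mulC-0ˡ : ∀ y → mulC d 0C y ≈ 0C
  mulC-0ˡ y U = trans (mulC-coord 0C y U) (∑-0 _ λ S → annihilate (ι (basisCoeff d S (S ⊕ U))) (y (S ⊕ U)))
    where
    annihilate : ∀ k b → k * (0ℚ * b) ≡ 0ℚ
    annihilate = solve-∀ ringℚ

  mulC-0ʳ : ∀ x → mulC d x 0C ≈ 0C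
  mulC-0ʳ x U = trans (mulC-coord x 0C U) (∑-0 _ λ S → annihilate (ι (basisCoeff d S (S ⊕ U))) (x S))
    where
    annihilate : ∀ k a → k * (a * 0ℚ) ≡ 0ℚ
    annihilate = solve-∀ ringℚ

γ : ∀ {m} → Subset m → Clf m
γ T S = when (S ≟ˢ T) 1ℚ

γ-same : ∀ {m} (T : Subset m) → γ T T ≡ 1ℚ
γ-same T = when-yes (T ≟ˢ T) 1ℚ refl

γ-diff : ∀ {m} {T S : Subset m} → S ≢ T → γ T S ≡ 0ℚ
γ-diff {T = T} {S} S≢T = when-no (S ≟ˢ T) 1ℚ S≢T

1C≈γ∅ : ∀ {m} → 1C {m} ≈ γ ∅
1C≈γ∅ S with S ≟ˢ ∅
... | yes _ = refl
... | no _ = refl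

module _ {m : ℕ} (d : Vec ℤ m) where

  mulC-γˡ : ∀ T y U → mulC d (γ T) y U ≡ ι (basisCoeff d T (T ⊕ U)) * y (T ⊕ U)
  mulC-γˡ T y U = trans (mulC-coord d (γ T) y U) (trans
    (∑-single (mulTerm d (γ T) y U) T λ S S≢T →
      trans (cong (λ g → ι (basisCoeff d S (S ⊕ U)) * (g * y (S ⊕ U))) (γ-diff S≢T)) (annihilate (ι (basisCoeff d S (S ⊕ U))) (y (S ⊕ U))))
    (trans (cong (λ g → ι (basisCoeff d T (T ⊕ U)) * (g * y (T ⊕ U))) (γ-same T)) (unit (ι (basisCoeff d T (T ⊕ U))) (y (T ⊕ U)))))
    where
    annihilate : ∀ k b → k * (0ℚ * b) ≡ 0ℚ
    annihilate = solve-∀ ringℚ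
    unit : ∀ k b → k * (1ℚ * b) ≡ k * b
    unit = solve-∀ ringℚ

  mulC-γʳ : ∀ x T U → mulC d x (γ T) U ≡ ι (basisCoeff d (U ⊕ T) T) * x (U ⊕ T)
  mulC-γʳ x T U = trans (mulC-coord d x (γ T) U) (trans
    (∑-single (mulTerm d x (γ T) U) (U ⊕ T) λ S S≢U⊕T →
      trans (cong (λ g → ι (basisCoeff d S (S ⊕ U)) * (x S * g)) (γ-diff (S≢U⊕T ∘ solve-for S)))
            (annihilate (ι (basisCoeff d S (S ⊕ U))) (x S)))
    (trans (cong₂ (λ V g → ι (basisCoeff d (U ⊕ T) V) * (x (U ⊕ T) * g)) [U⊕T]⊕U≡T
                  (trans (cong (γ T) [U⊕T]⊕U≡T) (γ-same T)))
           (unit (ι (basisCoeff d (U ⊕ T) T)) (x (U ⊕ T)))))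
    where
    [U⊕T]⊕U≡T : (U ⊕ T) ⊕ U ≡ T
    [U⊕T]⊕U≡T = trans (cong (_⊕ U) (⊕-comm U T)) (⊕-cancelʳ T U)
    solve-for : ∀ S → S ⊕ U ≡ T → S ≡ U ⊕ T
    solve-for S S⊕U≡T = trans (sym (⊕-cancelʳ S U)) (trans (cong (_⊕ U) S⊕U≡T) (⊕-comm T U))
    annihilate : ∀ k a → k * (a * 0ℚ) ≡ 0ℚ
    annihilate = solve-∀ ringℚ
    unit : ∀ k a → k * (a * 1ℚ) ≡ k * a
    unit = solve-∀ ringℚ

  mulC-γγ : ∀ S T → mulC d (γ S) (γ T) ≈ (ι (basisCoeff d S T) ·C γ (S ⊕ T))
  mulC-γγ S T U with U ≟ˢ (S ⊕ T)
  ... | yes refl = trans (mulC-γˡ S (γ T) (S ⊕ T))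
    (trans (cong (λ V → ι (basisCoeff d S V) * γ T V) (⊕-cancelˡ S T)) (cong (ι (basisCoeff d S T) *_) (γ-same T)))
  ... | no U≢S⊕T = trans (mulC-γˡ S (γ T) U) (trans
    (cong (ι (basisCoeff d S (S ⊕ U)) *_) (γ-diff λ S⊕U≡T → U≢S⊕T (trans (sym (⊕-cancelˡ S U)) (cong (S ⊕_) S⊕U≡T))))
    (trans (ℚP.*-zeroʳ (ι (basisCoeff d S (S ⊕ U)))) (sym (ℚP.*-zeroʳ (ι (basisCoeff d S T))))))

-- ℤ-submodules and the Clifford order
module _ {m : ℕ} where

  ≈-refl : {x : Clf m} → x ≈ x
  ≈-refl S = refl

  ≈-sym : {x y : Clf m} → x ≈ y → y ≈ x
  ≈-sym x≈y S = sym (x≈y S)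

  ≈-trans : {x y z : Clf m} → x ≈ y → y ≈ z → x ≈ z
  ≈-trans x≈y y≈z S = trans (x≈y S) (y≈z S)

  sumC-cong : ∀ k {f g : Fin k → Clf m} → (∀ i → f i ≈ g i) → sumC k f ≈ sumC k g
  sumC-cong zero f≈g S = refl
  sumC-cong (suc k) f≈g S = cong₂ _+_ (f≈g zero S) (sumC-cong k (λ i → f≈g (suc i)) S)

  sumC-+ : ∀ k (f g : Fin k → Clf m) → (sumC k f +C sumC k g) ≈ sumC k (λ i → f i +C g i)
  sumC-+ zero f g S = refl
  sumC-+ (suc k) f g S = trans (interchange (f zero S) (g zero S) _ _)
    (cong (_+_ (f zero S + g zero S)) (sumC-+ k (λ i → f (suc i)) (λ i → g (suc i)) S))
    where
    interchange : ∀ a b c e → (a + c) + (b + e) ≡ (a + b) + (c + e)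
    interchange = solve-∀ ringℚ

  sumC-· : ∀ k r (f : Fin k → Clf m) → (r ·C sumC k f) ≈ sumC k (λ i → r ·C f i)
  sumC-· zero r f S = ℚP.*-zeroʳ r
  sumC-· (suc k) r f S = trans (ℚP.*-distribˡ-+ r _ _) (cong (_+_ (r * f zero S)) (sumC-· k r (λ i → f (suc i)) S))

  sumC-0 : ∀ k (f : Fin k → Clf m) → (∀ i → f i ≈ 0C) → sumC k f ≈ 0C
  sumC-0 zero f f≈0 S = refl
  sumC-0 (suc k) f f≈0 S = trans (cong₂ _+_ (f≈0 zero S) (sumC-0 k (λ i → f (suc i)) (λ i → f≈0 (suc i)) S)) (ℚP.+-identityˡ 0ℚ)

  mulC-sumCˡ : ∀ d k (f : Fin k → Clf m) y → mulC d (sumC k f) y ≈ sumC k (λ i → mulC d (f i) y)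
  mulC-sumCˡ d zero f y = mulC-0ˡ d y
  mulC-sumCˡ d (suc k) f y S = trans (mulC-+ˡ d _ _ y S) (cong (_+_ (mulC d (f zero) y S)) (mulC-sumCˡ d k (λ i → f (suc i)) y S))

  mulC-sumCʳ : ∀ d k (f : Fin k → Clf m) x → mulC d x (sumC k f) ≈ sumC k (λ i → mulC d x (f i))
  mulC-sumCʳ d zero f x = mulC-0ʳ d x
  mulC-sumCʳ d (suc k) f x S = trans (mulC-+ʳ d x _ _ S) (cong (_+_ (mulC d x (f zero) S)) (mulC-sumCʳ d k (λ i → f (suc i)) x S))

  record IsSubmodule (P : Pred {m}) : Set where
    field
      resp-≈ : ∀ {x y} → x ≈ y → P x → P y
      0∈ : P 0C
      +-closed : ∀ {x y} → P x → P y → P (x +C y)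
      ℤ·-closed : ∀ c {x} → P x → P (ι c ·C x)

  module _ {P : Pred {m}} (P-sub : IsSubmodule P) where
    open IsSubmodule P-sub

    sumC-closed : ∀ k (f : Fin k → Clf m) → (∀ i → P (f i)) → P (sumC k f)
    sumC-closed zero f f∈P = 0∈
    sumC-closed (suc k) f f∈P = +-closed (f∈P zero) (sumC-closed k (λ i → f (suc i)) (λ i → f∈P (suc i)))

    combination-closed : ∀ k (f : Fin k → Clf m) → (∀ i → P (f i)) → (c : Fin k → ℤ) → P (sumC k (λ i → ι (c i) ·C f i))
    combination-closed k f f∈P c = sumC-closed k (λ i → ι (c i) ·C f i) (λ i → ℤ·-closed (c i) (f∈P i))

    -C-closed : ∀ {x} → P x → P (-C x)
    -C-closed {x} x∈P = resp-≈ (λ S → trans (cong (_* x S) (ι-homo‿- (+ 1))) (trans (sym (ℚP.neg-distribˡ-* 1ℚ (x S))) (cong -_ (ℚP.*-identityˡ (x S))))) (ℤ·-closed (ℤ.- + 1) x∈P)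

    ZSpan-least : ∀ k (g : Fin k → Clf m) → (∀ i → P (g i)) → ZSpan (k , g) ⊆ P
    ZSpan-least k g g∈P x (c , x≈∑cg) = resp-≈ {y = x} (≈-sym x≈∑cg) (combination-closed k g g∈P c)

  IsSubmodule-resp-≐ : ∀ {P Q} → P ≐ Q → IsSubmodule Q → IsSubmodule P
  IsSubmodule-resp-≐ (P⊆Q , Q⊆P) Q-sub = record
    { resp-≈ = λ x≈y x∈P → Q⊆P _ (resp-≈ x≈y (P⊆Q _ x∈P))
    ; 0∈ = Q⊆P _ 0∈
    ; +-closed = λ x∈P y∈P → Q⊆P _ (+-closed (P⊆Q _ x∈P) (P⊆Q _ y∈P))
    ; ℤ·-closed = λ c x∈P → Q⊆P _ (ℤ·-closed c (P⊆Q _ x∈P)) }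
    where open IsSubmodule Q-sub

  ZSpan-isSubmodule : (G : Gens {m}) → IsSubmodule (ZSpan G)
  ZSpan-isSubmodule (k , g) = record
    { resp-≈ = λ { x≈y (c , x≈∑) → c , ≈-trans (≈-sym x≈y) x≈∑ }
    ; 0∈ = (λ _ → + 0) , ≈-sym (sumC-0 k _ (λ i S → ℚP.*-zeroˡ (g i S)))
    ; +-closed = λ { (c , x≈∑) (c′ , y≈∑) → (λ i → c i ℤ.+ c′ i) ,
        ≈-trans (λ S → cong₂ _+_ (x≈∑ S) (y≈∑ S)) (≈-trans (sumC-+ k _ _)
          (sumC-cong k λ i S → sym (trans (cong (_* g i S) (ι-homo-+ (c i) (c′ i))) (ℚP.*-distribʳ-+ (g i S) (ι (c i)) (ι (c′ i)))))) }
    ; ℤ·-closed = λ { a (c , x≈∑) → (λ i → a ℤ.* c i) ,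
        ≈-trans (λ S → cong (ι a *_) (x≈∑ S)) (≈-trans (sumC-· k (ι a) _)
          (sumC-cong k λ i S → trans (sym (ℚP.*-assoc (ι a) (ι (c i)) (g i S))) (cong (_* g i S) (sym (ι-homo-* a (c i)))))) } }

  private
    δ : ∀ {k} → Fin k → Fin k → ℤ
    δ zero zero = + 1
    δ zero (suc j) = + 0
    δ (suc i) zero = + 0
    δ (suc i) (suc j) = δ i j

    sumC-δ : ∀ k (g : Fin k → Clf m) i → sumC k (λ j → ι (δ i j) ·C g j) ≈ g i
    sumC-δ (suc k) g zero S = trans (cong₂ _+_ (ℚP.*-identityˡ (g zero S)) (sumC-0 k _ (λ j S′ → ℚP.*-zeroˡ (g (suc j) S′)) S)) (ℚP.+-identityʳ _)
    sumC-δ (suc k) g (suc i) S = trans (cong₂ _+_ (ℚP.*-zeroˡ (g zero S)) (sumC-δ k (λ j → g (suc j)) i S)) (ℚP.+-identityˡ _)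

  generator∈ZSpan : ∀ k (g : Fin k → Clf m) i → ZSpan (k , g) (g i)
  generator∈ZSpan k g i = δ i , ≈-sym (sumC-δ k g i)

  ZSpan-mulClosed : ∀ d k (g : Fin k → Clf m) → (∀ i j → ZSpan (k , g) (mulC d (g i) (g j))) →
    ∀ x y → ZSpan (k , g) x → ZSpan (k , g) y → ZSpan (k , g) (mulC d x y)
  ZSpan-mulClosed d k g gg∈ x y (c , x≈∑) (c′ , y≈∑) =
    resp-≈ {y = mulC d x y} (≈-sym (≈-trans (mulC-cong d x≈∑ y≈∑) (≈-trans (mulC-sumCˡ d k (λ i → ι (c i) ·C g i) y′)
           (sumC-cong k λ i S → mulC-·ˡ d (ι (c i)) (g i) y′ S))))
      (combination-closed span k (λ i → mulC d (g i) y′) (λ i →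
        resp-≈ {y = mulC d (g i) y′} (≈-sym (≈-trans (mulC-sumCʳ d k (λ j → ι (c′ j) ·C g j) (g i)) (sumC-cong k λ j S → mulC-·ʳ d (ι (c′ j)) (g i) (g j) S)))
          (combination-closed span k (λ j → mulC d (g i) (g j)) (gg∈ i) c′)) c)
    where
    span = ZSpan-isSubmodule (k , g)
    open IsSubmodule span
    y′ = sumC k (λ j → ι (c′ j) ·C g j)

allSubsets-complete : ∀ {m} (S : Subset m) → S ∈ allSubsets m
allSubsets-complete [] = here refl
allSubsets-complete (true ∷ S) = ∈-++⁺ˡ (∈-map⁺ (true ∷_) (allSubsets-complete S))
allSubsets-complete {suc m} (false ∷ S) = ∈-++⁺ʳ (map (true ∷_) (allSubsets m)) (∈-map⁺ (false ∷_) (allSubsets-complete S))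

module _ {m : ℕ} where

  CliffordOrder-isSubmodule : IsSubmodule (CliffordOrder {m})
  CliffordOrder-isSubmodule = record
    { resp-≈ = λ x≈y x∈Λ S → proj₁ (x∈Λ S) , trans (sym (x≈y S)) (proj₂ (x∈Λ S))
    ; 0∈ = λ S → + 0 , refl
    ; +-closed = λ x∈Λ y∈Λ S → isInteger-+ (x∈Λ S) (y∈Λ S)
    ; ℤ·-closed = λ c x∈Λ S → isInteger-* (c , refl) (x∈Λ S) }

  γ∈CliffordOrder : (T : Subset m) → CliffordOrder (γ T)
  γ∈CliffordOrder T S with S ≟ˢ T
  ... | yes _ = + 1 , refl
  ... | no _ = + 0 , refl

  CliffordOrder? : (x : Clf m) → Dec (CliffordOrder x)
  CliffordOrder? x = Dec.map′ (λ all S → All.lookup all (allSubsets-complete S)) (λ x∈Λ → All.tabulate (λ {S} _ → x∈Λ S))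
    (All.all? (λ S → isInteger? (x S)) (allSubsets m))

  basisGens : Gens {m}
  basisGens = length (allSubsets m) , λ i → γ (List.lookup (allSubsets m) i)

  private
    sumC-lookup : ∀ (L : List (Subset m)) (f : Subset m → Clf m) U →
      sumC (length L) (λ i → f (List.lookup L i)) U ≡ ∑ₗ L (λ S → f S U)
    sumC-lookup [] f U = refl
    sumC-lookup (S ∷ L) f U = cong (_+_ (f S U)) (sumC-lookup L f U)

  sumC-basis : (c : Clf m) → sumC (length (allSubsets m)) (λ i → c (List.lookup (allSubsets m) i) ·C γ (List.lookup (allSubsets m) i)) ≈ c
  sumC-basis c U = trans (sumC-lookup (allSubsets m) (λ S → c S ·C γ S) U) (trans
    (∑-single (λ S → c S * γ S U) U (λ S S≢U → trans (cong (c S *_) (γ-diff (S≢U ∘ sym))) (ℚP.*-zeroʳ (c S))))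
    (trans (cong (c U *_) (γ-same U)) (ℚP.*-identityʳ (c U))))

  CliffordOrder⊆ZSpan-basis : CliffordOrder ⊆ ZSpan basisGens
  CliffordOrder⊆ZSpan-basis x x∈Λ = (λ i → proj₁ (x∈Λ (List.lookup (allSubsets m) i))) ,
    ≈-sym (≈-trans (sumC-cong _ λ i S → cong (_* γ (List.lookup (allSubsets m) i) S) (sym (proj₂ (x∈Λ (List.lookup (allSubsets m) i)))))
                   (sumC-basis x))

  ZSpan-basis⊆CliffordOrder : ZSpan basisGens ⊆ CliffordOrder
  ZSpan-basis⊆CliffordOrder = ZSpan-least CliffordOrder-isSubmodule _ _ (λ i → γ∈CliffordOrder (List.lookup (allSubsets m) i))

  IsOrder-resp-≐ : ∀ {d : Vec ℤ m} {O O′ : Pred {m}} → IsOrder d O → O ≐ O′ → IsOrder d O′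
  IsOrder-resp-≐ {d} {O} O-order (O⊆O′ , O′⊆O) = record
    { one = O⊆O′ 1C one
    ; add = λ x y x∈ y∈ → O⊆O′ (x +C y) (add x y (O′⊆O x x∈) (O′⊆O y y∈))
    ; neg = λ x x∈ → O⊆O′ (-C x) (neg x (O′⊆O x x∈))
    ; mul = λ x y x∈ y∈ → O⊆O′ (mulC d x y) (mul x y (O′⊆O x x∈) (O′⊆O y y∈))
    ; finGen = proj₁ finGen , (λ x x∈ → proj₁ (proj₂ finGen) x (O′⊆O x x∈)) , (λ x x∈ → O⊆O′ x (proj₂ (proj₂ finGen) x x∈))
    ; spans = λ x → let (k , v , v∈O , rest) = spans x in k , v , (λ i → O⊆O′ (v i) (v∈O i)) , rest }
    where open IsOrder O-order

  IsOrder⇒IsSubmodule : ∀ {d : Vec ℤ m} {O : Pred {m}} → IsOrder d O → IsSubmodule O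
  IsOrder⇒IsSubmodule O-order = IsSubmodule-resp-≐ (proj₂ (IsOrder.finGen O-order)) (ZSpan-isSubmodule (proj₁ (IsOrder.finGen O-order)))

-- Averaging over conjugation by the generators
*-≢0 : ∀ {i j : ℤ} → i ≢ + 0 → j ≢ + 0 → i ℤ.* j ≢ + 0
*-≢0 {i} i≢0 j≢0 ij≡0 with ℤP.i*j≡0⇒i≡0∨j≡0 i ij≡0
... | inj₁ i≡0 = i≢0 i≡0
... | inj₂ j≡0 = j≢0 j≡0

sgn-±1 : ∀ n → sgn n ≡ + 1 ⊎ sgn n ≡ -[1+ 0 ]
sgn-±1 zero = inj₁ refl
sgn-±1 (suc n) with sgn-±1 n
... | inj₁ eq = inj₂ (cong ℤ.-_ eq)
... | inj₂ eq = inj₁ (cong ℤ.-_ eq)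

sgn≢0 : ∀ n → sgn n ≢ + 0
sgn≢0 zero ()
sgn≢0 (suc n) eq = sgn≢0 n (ℤP.neg-injective eq)

card-∅ : ∀ m → card (∅ {m}) ≡ 0
card-∅ zero = refl
card-∅ (suc m) = card-∅ m

card-full : ∀ m → card (full {m}) ≡ m
card-full zero = refl
card-full (suc m) = cong suc (card-full m)

basisCoeff-∅ˡ : ∀ {m} (d : Vec ℤ m) T → basisCoeff d ∅ T ≡ + 1
basisCoeff-∅ˡ [] [] = refl
basisCoeff-∅ˡ {suc m} (_ ∷ d) (true ∷ T) rewrite card-∅ m | basisCoeff-∅ˡ d T = refl
basisCoeff-∅ˡ (_ ∷ d) (false ∷ T) rewrite basisCoeff-∅ˡ d T = refl

basisCoeff-∅ʳ : ∀ {m} (d : Vec ℤ m) S → basisCoeff d S ∅ ≡ + 1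
basisCoeff-∅ʳ [] [] = refl
basisCoeff-∅ʳ (_ ∷ d) (true ∷ S) rewrite basisCoeff-∅ʳ d S = refl
basisCoeff-∅ʳ (_ ∷ d) (false ∷ S) rewrite basisCoeff-∅ʳ d S = refl

basisCoeff-self≢0 : ∀ {m} (d : Vec ℤ m) → Nondegenerate d → ∀ S → basisCoeff d S S ≢ + 0
basisCoeff-self≢0 [] _ [] ()
basisCoeff-self≢0 (d₀ ∷ d) nd (true ∷ S) =
  *-≢0 (sgn≢0 (card S)) (*-≢0 (λ -d₀≡0 → nd zero (trans (sym (ℤP.neg-involutive d₀)) (cong ℤ.-_ -d₀≡0)))
                               (basisCoeff-self≢0 d (λ i → nd (suc i)) S))
basisCoeff-self≢0 (d₀ ∷ d) nd (false ∷ S) =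
  *-≢0 {+ 1} (λ ()) (*-≢0 {+ 1} (λ ()) (basisCoeff-self≢0 d (λ i → nd (suc i)) S))

card-⁅⁆ : ∀ {m} (i : Fin m) → card ⁅ i ⁆ ≡ 1
card-⁅⁆ {suc m} zero = cong suc (card-∅ m)
card-⁅⁆ (suc i) = card-⁅⁆ i

-- γᵢ γ_U = σ i U · γ_U γᵢ, where σ i U = (-1)^(|U| - [i ∈ U]).
σ : ∀ {m} → Fin m → Subset m → ℤ
σ zero (_ ∷ U) = sgn (card U)
σ (suc i) (true ∷ U) = ℤ.- σ i U
σ (suc i) (false ∷ U) = σ i U

conjugationCoeff : ∀ {m} (d : Vec ℤ m) i U →
  basisCoeff d (U ⊕ ⁅ i ⁆) ⁅ i ⁆ ℤ.* basisCoeff d ⁅ i ⁆ U ≡ ℤ.- lookup d i ℤ.* σ i U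
conjugationCoeff {suc m} (d₀ ∷ d) zero (true ∷ U)
  rewrite card-∅ m | basisCoeff-∅ˡ d U | ⊕-identityʳ U | basisCoeff-∅ʳ d U = normalise d₀ (sgn (card U))
  where
  normalise : ∀ a s → (s ℤ.* (+ 1 ℤ.* + 1)) ℤ.* (+ 1 ℤ.* (ℤ.- a ℤ.* + 1)) ≡ ℤ.- a ℤ.* s
  normalise = solveℤ
conjugationCoeff {suc m} (d₀ ∷ d) zero (false ∷ U)
  rewrite basisCoeff-∅ˡ d U | ⊕-identityʳ U | basisCoeff-∅ʳ d U = normalise d₀ (sgn (card U))
  where
  normalise : ∀ a s → (s ℤ.* (ℤ.- a ℤ.* + 1)) ℤ.* (+ 1 ℤ.* (+ 1 ℤ.* + 1)) ≡ ℤ.- a ℤ.* s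
  normalise = solveℤ
conjugationCoeff (d₀ ∷ d) (suc i) (true ∷ U)
  rewrite card-⁅⁆ i = trans (normalise (basisCoeff d (U ⊕ ⁅ i ⁆) ⁅ i ⁆) (basisCoeff d ⁅ i ⁆ U))
                            (trans (cong ℤ.-_ (conjugationCoeff d i U)) (ℤP.neg-distribʳ-* (ℤ.- lookup d i) (σ i U)))
  where
  normalise : ∀ a b → (+ 1 ℤ.* (+ 1 ℤ.* a)) ℤ.* (ℤ.- (+ 1) ℤ.* (+ 1 ℤ.* b)) ≡ ℤ.- (a ℤ.* b)
  normalise = solveℤ
conjugationCoeff (d₀ ∷ d) (suc i) (false ∷ U) =
  trans (normalise (basisCoeff d (U ⊕ ⁅ i ⁆) ⁅ i ⁆) (basisCoeff d ⁅ i ⁆ U)) (conjugationCoeff d i U)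
  where
  normalise : ∀ a b → (+ 1 ℤ.* (+ 1 ℤ.* a)) ℤ.* (+ 1 ℤ.* (+ 1 ℤ.* b)) ≡ a ℤ.* b
  normalise = solveℤ

σ-∅ : ∀ {m} (i : Fin m) → σ i ∅ ≡ + 1
σ-∅ {suc m} zero = cong sgn (card-∅ m)
σ-∅ (suc i) = σ-∅ i

σ-∈ : ∀ {m} (i : Fin m) U → lookup U i ≡ true → σ i U ≡ ℤ.- sgn (card U)
σ-∈ zero (true ∷ U) _ = sym (ℤP.neg-involutive _)
σ-∈ (suc i) (true ∷ U) i∈U = cong ℤ.-_ (σ-∈ i U i∈U)
σ-∈ (suc i) (false ∷ U) i∈U = σ-∈ i U i∈U

σ-∉ : ∀ {m} (i : Fin m) U → lookup U i ≡ false → σ i U ≡ sgn (card U)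
σ-∉ zero (false ∷ U) _ = refl
σ-∉ (suc i) (true ∷ U) i∉U = cong ℤ.-_ (σ-∉ i U i∉U)
σ-∉ (suc i) (false ∷ U) i∉U = σ-∉ i U i∉U

nonempty⇒∈ : ∀ {m} (U : Subset m) → U ≢ ∅ → ∃ λ i → lookup U i ≡ true
nonempty⇒∈ [] U≢∅ = ⊥-elim (U≢∅ refl)
nonempty⇒∈ (true ∷ U) _ = zero , refl
nonempty⇒∈ (false ∷ U) U≢∅ with nonempty⇒∈ U (U≢∅ ∘ cong (false ∷_))
... | i , i∈U = suc i , i∈U

nonfull⇒∉ : ∀ {m} (U : Subset m) → U ≢ full → ∃ λ i → lookup U i ≡ false
nonfull⇒∉ [] U≢full = ⊥-elim (U≢full refl)
nonfull⇒∉ (false ∷ U) _ = zero , refl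
nonfull⇒∉ (true ∷ U) U≢full with nonfull⇒∉ U (U≢full ∘ cong (true ∷_))
... | i , i∉U = suc i , i∉U

anticommuting-generator : ∀ {m} (U : Subset m) → U ≢ ∅ → (U ≡ full → sgn m ≡ + 1) → ∃ λ i → σ i U ≡ -[1+ 0 ]
anticommuting-generator {m} U U≢∅ full⇒even with sgn-±1 (card U)
... | inj₁ even with nonempty⇒∈ U U≢∅
...   | i , i∈U = i , trans (σ-∈ i U i∈U) (cong ℤ.-_ even)
anticommuting-generator {m} U U≢∅ full⇒even | inj₂ odd with U ≟ˢ full
...   | yes refl = ⊥-elim (+1≢-1 (trans (sym (full⇒even refl)) (trans (cong sgn (sym (card-full m))) odd)))
  where
  +1≢-1 : + 1 ≢ -[1+ 0 ]
  +1≢-1 ()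
...   | no U≢full with nonfull⇒∉ U U≢full
...     | i , i∉U = i , trans (σ-∉ i U i∉U) odd

module _ {m : ℕ} (d : Vec ℤ m) where

  average : Fin m → Clf m → Clf m
  average i z = (ι (lookup d i) ·C z) +C (-C (mulC d (mulC d (γ ⁅ i ⁆) z) (γ ⁅ i ⁆)))

  averageFactor : Fin m → Subset m → ℤ
  averageFactor i U = lookup d i ℤ.* (+ 1 ℤ.+ σ i U)

  average-coord : ∀ i z U → average i z U ≡ ι (averageFactor i U) * z U
  average-coord i z U = begin
    ι dᵢ * z U + - mulC d (mulC d (γ I) z) (γ I) U
      ≡⟨ cong (λ w → ι dᵢ * z U + - w) (trans (mulC-γʳ d (mulC d (γ I) z) I U) (cong (ι (basisCoeff d (U ⊕ I) I) *_) (mulC-γˡ d I z (U ⊕ I)))) ⟩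
    ι dᵢ * z U + - (ι (basisCoeff d (U ⊕ I) I) * (ι (basisCoeff d I (I ⊕ (U ⊕ I))) * z (I ⊕ (U ⊕ I))))
      ≡⟨ cong (λ V → ι dᵢ * z U + - (ι (basisCoeff d (U ⊕ I) I) * (ι (basisCoeff d I V) * z V))) I⊕[U⊕I]≡U ⟩
    ι dᵢ * z U + - (ι (basisCoeff d (U ⊕ I) I) * (ι (basisCoeff d I U) * z U))
      ≡⟨ cong (λ w → ι dᵢ * z U + - w) (trans (sym (ℚP.*-assoc (ι (basisCoeff d (U ⊕ I) I)) (ι (basisCoeff d I U)) (z U))) (cong (_* z U) (sym (ι-homo-* (basisCoeff d (U ⊕ I) I) (basisCoeff d I U))))) ⟩
    ι dᵢ * z U + - (ι (basisCoeff d (U ⊕ I) I ℤ.* basisCoeff d I U) * z U)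
      ≡⟨ cong (λ k → ι dᵢ * z U + - (ι k * z U)) (conjugationCoeff d i U) ⟩
    ι dᵢ * z U + - (ι (ℤ.- dᵢ ℤ.* σ i U) * z U)
      ≡⟨ cong (λ w → ι dᵢ * z U + - (w * z U)) (trans (ι-homo-* (ℤ.- dᵢ) (σ i U)) (cong (_* ι (σ i U)) (ι-homo‿- dᵢ))) ⟩
    ι dᵢ * z U + - ((- ι dᵢ * ι (σ i U)) * z U)
      ≡⟨ rearrange (ι dᵢ) (ι (σ i U)) (z U) ⟩
    (ι dᵢ * (1ℚ + ι (σ i U))) * z U
      ≡⟨ cong (_* z U) (trans (cong (ι dᵢ *_) (sym (ι-homo-+ (+ 1) (σ i U)))) (sym (ι-homo-* dᵢ (+ 1 ℤ.+ σ i U)))) ⟩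
    ι (averageFactor i U) * z U ∎
    where
    open ≡-Reasoning
    I = ⁅ i ⁆
    dᵢ = lookup d i
    I⊕[U⊕I]≡U : I ⊕ (U ⊕ I) ≡ U
    I⊕[U⊕I]≡U = trans (cong (I ⊕_) (⊕-comm U I)) (⊕-cancelˡ I U)
    rearrange : ∀ a s x → a * x + - ((- a * s) * x) ≡ (a * (1ℚ + s)) * x
    rearrange = solve-∀ ringℚ

  averageOver : List (Fin m) → Clf m → Clf m
  averageOver [] z = z
  averageOver (i ∷ is) z = average i (averageOver is z)

  averageFactors : List (Fin m) → Subset m → ℤ
  averageFactors [] U = + 1
  averageFactors (i ∷ is) U = averageFactor i U ℤ.* averageFactors is U

  averageOver-coord : ∀ is z U → averageOver is z U ≡ ι (averageFactors is U) * z U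
  averageOver-coord [] z U = sym (ℚP.*-identityˡ (z U))
  averageOver-coord (i ∷ is) z U = begin
    average i (averageOver is z) U                       ≡⟨ average-coord i (averageOver is z) U ⟩
    ι (averageFactor i U) * averageOver is z U            ≡⟨ cong (ι (averageFactor i U) *_) (averageOver-coord is z U) ⟩
    ι (averageFactor i U) * (ι (averageFactors is U) * z U) ≡⟨ ℚP.*-assoc (ι (averageFactor i U)) (ι (averageFactors is U)) (z U) ⟨
    (ι (averageFactor i U) * ι (averageFactors is U)) * z U ≡⟨ cong (_* z U) (ι-homo-* (averageFactor i U) (averageFactors is U)) ⟨
    ι (averageFactors (i ∷ is) U) * z U                  ∎
    where open ≡-Reasoning

  averageFactors-vanish : ∀ is U {i} → i ∈ is → σ i U ≡ -[1+ 0 ] → averageFactors is U ≡ + 0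
  averageFactors-vanish (i ∷ is) U (here refl) σ≡-1 rewrite σ≡-1 | ℤP.*-zeroʳ (lookup d i) = refl
  averageFactors-vanish (j ∷ is) U (there i∈is) σ≡-1 rewrite averageFactors-vanish is U i∈is σ≡-1 = ℤP.*-zeroʳ (averageFactor j U)

  averageFactors-∅≢0 : Nondegenerate d → ∀ is → averageFactors is ∅ ≢ + 0
  averageFactors-∅≢0 nd [] ()
  averageFactors-∅≢0 nd (i ∷ is) rewrite σ-∅ i = *-≢0 (*-≢0 (nd i) (λ ())) (averageFactors-∅≢0 nd is)

-- The ℚ-algebra ℚ[ω]/(ω² - δ); a pair (a , b) stands for a + b ω.
module QuadraticAlgebra (δ : ℤ) where

  Quad : Set
  Quad = ℚ × ℚ

  infixl 7 _⋆_
  _⋆_ : Quad → Quad → Quad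
  (a , b) ⋆ (c , e) = (a * c + ι δ * (b * e) , a * e + b * c)

  infixl 6 _⊞_
  _⊞_ : Quad → Quad → Quad
  (a , b) ⊞ (c , e) = (a + c , b + e)

  conj : Quad → Quad
  conj (a , b) = (a , - b)

  one : Quad
  one = (1ℚ , 0ℚ)

  infixr 8 _^ᵠ_
  _^ᵠ_ : Quad → ℕ → Quad
  u ^ᵠ zero = one
  u ^ᵠ suc k = u ⋆ u ^ᵠ k

  ⋆-assoc : ∀ p q r → (p ⋆ q) ⋆ r ≡ p ⋆ (q ⋆ r)
  ⋆-assoc (a , b) (c , e) (f , g) = cong₂ _,_ (first a b c e f g (ι δ)) (second a b c e f g (ι δ))
    where
    first : ∀ a b c e f g t → (a * c + t * (b * e)) * f + t * ((a * e + b * c) * g) ≡ a * (c * f + t * (e * g)) + t * (b * (c * g + e * f))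
    first = solve-∀ ringℚ
    second : ∀ a b c e f g t → (a * c + t * (b * e)) * g + (a * e + b * c) * f ≡ a * (c * g + e * f) + b * (c * f + t * (e * g))
    second = solve-∀ ringℚ

  ⋆-comm : ∀ p q → p ⋆ q ≡ q ⋆ p
  ⋆-comm (a , b) (c , e) = cong₂ _,_ (first a b c e (ι δ)) (second a b c e)
    where
    first : ∀ a b c e t → a * c + t * (b * e) ≡ c * a + t * (e * b)
    first = solve-∀ ringℚ
    second : ∀ a b c e → a * e + b * c ≡ c * b + e * a
    second = solve-∀ ringℚ

  ⋆-distribʳ : ∀ p q r → (q ⊞ r) ⋆ p ≡ q ⋆ p ⊞ r ⋆ p
  ⋆-distribʳ (a , b) (c , e) (f , g) = cong₂ _,_ (first a b c e f g (ι δ)) (second a b c e f g)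
    where
    first : ∀ a b c e f g t → (c + f) * a + t * ((e + g) * b) ≡ (c * a + t * (e * b)) + (f * a + t * (g * b))
    first = solve-∀ ringℚ
    second : ∀ a b c e f g → (c + f) * b + (e + g) * a ≡ (c * b + e * a) + (f * b + g * a)
    second = solve-∀ ringℚ

  ⋆-distribˡ : ∀ p q r → p ⋆ (q ⊞ r) ≡ p ⋆ q ⊞ p ⋆ r
  ⋆-distribˡ p q r = trans (⋆-comm p (q ⊞ r)) (trans (⋆-distribʳ p q r) (cong₂ _⊞_ (⋆-comm q p) (⋆-comm r p)))

  ⋆-identityˡ : ∀ p → one ⋆ p ≡ p
  ⋆-identityˡ (a , b) = cong₂ _,_ (first a b (ι δ)) (second a b)
    where
    first : ∀ a b t → 1ℚ * a + t * (0ℚ * b) ≡ a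
    first = solve-∀ ringℚ
    second : ∀ a b → 1ℚ * b + 0ℚ * a ≡ b
    second = solve-∀ ringℚ

  conj-⋆ : ∀ p q → conj (p ⋆ q) ≡ conj p ⋆ conj q
  conj-⋆ (a , b) (c , e) = cong₂ _,_ (first a b c e (ι δ)) (second a b c e)
    where
    first : ∀ a b c e t → a * c + t * (b * e) ≡ a * c + t * (- b * - e)
    first = solve-∀ ringℚ
    second : ∀ a b c e → - (a * e + b * c) ≡ a * - e + - b * c
    second = solve-∀ ringℚ

  conj-^ᵠ : ∀ u k → conj u ^ᵠ k ≡ conj (u ^ᵠ k)
  conj-^ᵠ u zero = cong (1ℚ ,_) refl
  conj-^ᵠ u (suc k) = trans (cong (conj u ⋆_) (conj-^ᵠ u k)) (sym (conj-⋆ u (u ^ᵠ k)))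

  ^ᵠ-real : ∀ c k → (c , 0ℚ) ^ᵠ k ≡ (c ^ k , 0ℚ)
  ^ᵠ-real c zero = refl
  ^ᵠ-real c (suc k) rewrite ^ᵠ-real c k = cong₂ _,_ (first c (c ^ k) (ι δ)) (second c (c ^ k))
    where
    first : ∀ c p t → c * p + t * (0ℚ * 0ℚ) ≡ c * p
    first = solve-∀ ringℚ
    second : ∀ c p → c * 0ℚ + 0ℚ * p ≡ 0ℚ
    second = solve-∀ ringℚ

  record Bounded (D : ℤ) (p : Quad) : Set where
    constructor bounded
    field
      first : IsInteger (ι D * proj₁ p)
      second : IsInteger (ι D * proj₂ p)

  Bounded-⋆ : ∀ {D p q} → Bounded D p → Bounded D q → Bounded (D ℤ.* D) (p ⋆ q)
  Bounded-⋆ {D} {a , b} {c , e} (bounded Da∈ℤ Db∈ℤ) (bounded Dc∈ℤ De∈ℤ) = bounded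
    (isInteger-resp (sym (trans (cong (_* _) (ι-homo-* D D)) (first (ι D) a b c e (ι δ))))
      (isInteger-+ (isInteger-* Da∈ℤ Dc∈ℤ) (isInteger-* (δ , refl) (isInteger-* Db∈ℤ De∈ℤ))))
    (isInteger-resp (sym (trans (cong (_* _) (ι-homo-* D D)) (second (ι D) a b c e)))
      (isInteger-+ (isInteger-* Da∈ℤ De∈ℤ) (isInteger-* Db∈ℤ Dc∈ℤ)))
    where
    first : ∀ D a b c e t → (D * D) * (a * c + t * (b * e)) ≡ (D * a) * (D * c) + t * ((D * b) * (D * e))
    first = solve-∀ ringℚ
    second : ∀ D a b c e → (D * D) * (a * e + b * c) ≡ (D * a) * (D * e) + (D * b) * (D * c)
    second = solve-∀ ringℚ

  Bounded-⊞ : ∀ {D p q} → Bounded D p → Bounded D q → Bounded D (p ⊞ q)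
  Bounded-⊞ {D} {a , b} {c , e} (bounded Da∈ℤ Db∈ℤ) (bounded Dc∈ℤ De∈ℤ) = bounded
    (isInteger-resp (sym (ℚP.*-distribˡ-+ (ι D) a c)) (isInteger-+ Da∈ℤ Dc∈ℤ))
    (isInteger-resp (sym (ℚP.*-distribˡ-+ (ι D) b e)) (isInteger-+ Db∈ℤ De∈ℤ))

  Bounded-conj : ∀ {D p} → Bounded D p → Bounded D (conj p)
  Bounded-conj {D} {a , b} (bounded Da∈ℤ Db∈ℤ) = bounded Da∈ℤ (isInteger-resp (ℚP.neg-distribʳ-* (ι D) b) (isInteger-‿ Db∈ℤ))

  module _ (u : Quad) where

  ⋆-identityʳ : ∀ p → p ⋆ one ≡ p
  ⋆-identityʳ p = trans (⋆-comm p one) (⋆-identityˡ p)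

  -- Expanding (u + ū)^k into monomials u^i ū^j, whose denominators divide D², shows that the powers
  -- of the rational number 2a = u + ū have bounded denominators.
  trace-isInteger : ∀ D .{{_ : ℕ.NonZero D}} → ∀ u → (∀ k → Bounded (+ D) (u ^ᵠ k)) → IsInteger (proj₁ u + proj₁ u)
  trace-isInteger D u@(a , b) u^k-bounded =
    bounded-powers⇒isInteger (D ℕ.* D) {{ℕP.m*n≢0 D D}} (a + a) λ k →
      isInteger-resp (cong₂ (λ n q → ι n * q) (sym (ℤP.pos-* D D)) (first-of-s^k k)) (Bounded.first (monomials-bounded k 0 0))
    where
    ū = conj u
    s = u ⊞ ū

    ū^j-bounded : ∀ j → Bounded (+ D) (ū ^ᵠ j)
    ū^j-bounded j = subst (Bounded (+ D)) (sym (conj-^ᵠ u j)) (Bounded-conj (u^k-bounded j))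

    s-shift : ∀ t x y → (s ⋆ t) ⋆ (x ⋆ y) ≡ t ⋆ ((u ⋆ x) ⋆ y) ⊞ t ⋆ (x ⋆ (ū ⋆ y))
    s-shift t x y = begin
      (s ⋆ t) ⋆ (x ⋆ y)                        ≡⟨ cong (_⋆ (x ⋆ y)) (⋆-comm s t) ⟩
      (t ⋆ s) ⋆ (x ⋆ y)                        ≡⟨ ⋆-assoc t s (x ⋆ y) ⟩
      t ⋆ (s ⋆ (x ⋆ y))                        ≡⟨ cong (t ⋆_) (⋆-distribʳ (x ⋆ y) u ū) ⟩
      t ⋆ (u ⋆ (x ⋆ y) ⊞ ū ⋆ (x ⋆ y))          ≡⟨ ⋆-distribˡ t _ _ ⟩
      t ⋆ (u ⋆ (x ⋆ y)) ⊞ t ⋆ (ū ⋆ (x ⋆ y))    ≡⟨ cong₂ (λ p q → t ⋆ p ⊞ t ⋆ q) (sym (⋆-assoc u x y)) ū-slides ⟩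
      t ⋆ ((u ⋆ x) ⋆ y) ⊞ t ⋆ (x ⋆ (ū ⋆ y))    ∎
      where
      open ≡-Reasoning
      ū-slides : ū ⋆ (x ⋆ y) ≡ x ⋆ (ū ⋆ y)
      ū-slides = trans (sym (⋆-assoc ū x y)) (trans (cong (_⋆ y) (⋆-comm ū x)) (⋆-assoc x ū y))

    monomials-bounded : ∀ k i j → Bounded (+ D ℤ.* + D) (s ^ᵠ k ⋆ (u ^ᵠ i ⋆ ū ^ᵠ j))
    monomials-bounded zero i j =
      subst (Bounded _) (sym (⋆-identityˡ _)) (Bounded-⋆ (u^k-bounded i) (ū^j-bounded j))
    monomials-bounded (suc k) i j =
      subst (Bounded _) (sym (s-shift (s ^ᵠ k) (u ^ᵠ i) (ū ^ᵠ j))) (Bounded-⊞ (monomials-bounded k (suc i) j) (monomials-bounded k i (suc j)))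

    first-of-s^k : ∀ k → proj₁ (s ^ᵠ k ⋆ (one ⋆ one)) ≡ (a + a) ^ k
    first-of-s^k k = cong proj₁ (begin
      s ^ᵠ k ⋆ (one ⋆ one)        ≡⟨ cong (s ^ᵠ k ⋆_) (⋆-identityˡ one) ⟩
      s ^ᵠ k ⋆ one                ≡⟨ ⋆-identityʳ (s ^ᵠ k) ⟩
      s ^ᵠ k                      ≡⟨ cong (λ e → (a + a , e) ^ᵠ k) (ℚP.+-inverseʳ b) ⟩
      (a + a , 0ℚ) ^ᵠ k           ≡⟨ ^ᵠ-real (a + a) k ⟩
      ((a + a) ^ k , 0ℚ)          ∎)
      where open ≡-Reasoning

module _ {m : ℕ} (d : Vec ℤ m) where

  open QuadraticAlgebra (basisCoeff d full full)

  embed : Quad → Clf m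
  embed (a , b) = (a ·C γ ∅) +C (b ·C γ full)

  private
    scaled-γγ : ∀ r r′ S T U → mulC d (r ·C γ S) (r′ ·C γ T) U ≡ r * (r′ * (ι (basisCoeff d S T) * γ (S ⊕ T) U))
    scaled-γγ r r′ S T U = trans (mulC-·ˡ d r (γ S) (r′ ·C γ T) U)
      (cong (r *_) (trans (mulC-·ʳ d r′ (γ S) (γ T) U) (cong (r′ *_) (mulC-γγ d S T U))))

  embed-⋆ : ∀ p q → mulC d (embed p) (embed q) ≈ embed (p ⋆ q)
  embed-⋆ (a , b) (c , e) U = begin
    mulC d (A +C B) (C +C E) U
      ≡⟨ trans (mulC-+ˡ d A B (C +C E) U) (cong₂ _+_ (mulC-+ʳ d A C E U) (mulC-+ʳ d B C E U)) ⟩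
    (mulC d A C U + mulC d A E U) + (mulC d B C U + mulC d B E U)
      ≡⟨ cong₂ _+_ (cong₂ _+_ (scaled-γγ a c ∅ ∅ U) (scaled-γγ a e ∅ full U))
                   (cong₂ _+_ (scaled-γγ b c full ∅ U) (scaled-γγ b e full full U)) ⟩
    (a * (c * (ι (basisCoeff d ∅ ∅) * γ (∅ ⊕ ∅) U)) + a * (e * (ι (basisCoeff d ∅ full) * γ (∅ ⊕ full) U)))
      + (b * (c * (ι (basisCoeff d full ∅) * γ (full ⊕ ∅) U)) + b * (e * (ι δ * γ (full ⊕ full) U)))
      ≡⟨ cong₂ _+_ (cong₂ _+_ (cong₂ (λ k V → a * (c * (ι k * γ V U))) (basisCoeff-∅ˡ d ∅) (⊕-identityˡ ∅))
                               (cong₂ (λ k V → a * (e * (ι k * γ V U))) (basisCoeff-∅ˡ d full) (⊕-identityˡ full)))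
                   (cong₂ _+_ (cong₂ (λ k V → b * (c * (ι k * γ V U))) (basisCoeff-∅ʳ d full) (⊕-identityʳ full))
                               (cong (λ V → b * (e * (ι δ * γ V U))) (⊕-self full))) ⟩
    (a * (c * (1ℚ * γ ∅ U)) + a * (e * (1ℚ * γ full U))) + (b * (c * (1ℚ * γ full U)) + b * (e * (ι δ * γ ∅ U)))
      ≡⟨ collect a b c e (ι δ) (γ ∅ U) (γ full U) ⟩
    embed ((a , b) ⋆ (c , e)) U ∎
    where
    open ≡-Reasoning
    δ = basisCoeff d full full
    A = a ·C γ ∅
    B = b ·C γ full
    C = c ·C γ ∅
    E = e ·C γ full
    collect : ∀ a b c e t x y →
      (a * (c * (1ℚ * x)) + a * (e * (1ℚ * y))) + (b * (c * (1ℚ * y)) + b * (e * (t * x)))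
        ≡ (a * c + t * (b * e)) * x + (a * e + b * c) * y
    collect = solve-∀ ringℚ

  powC : Clf m → ℕ → Clf m
  powC y zero = 1C
  powC y (suc k) = mulC d y (powC y k)

  powC-embed : ∀ {y} u → y ≈ embed u → ∀ k → powC y k ≈ embed (u ^ᵠ k)
  powC-embed u y≈u zero U = trans (1C≈γ∅ U) (pad (γ ∅ U) (γ full U))
    where
    pad : ∀ x y → x ≡ 1ℚ * x + 0ℚ * y
    pad = solve-∀ ringℚ
  powC-embed u y≈u (suc k) = ≈-trans (mulC-cong d y≈u (powC-embed u y≈u k)) (embed-⋆ u (u ^ᵠ k))

  embed-∅ : full {m} ≢ ∅ → ∀ p → embed p ∅ ≡ proj₁ p
  embed-∅ full≢∅ (a , b) = trans (cong₂ (λ x y → a * x + b * y) (γ-same (∅ {m})) (γ-diff (full≢∅ ∘ sym))) (simplify a b)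
    where
    simplify : ∀ a b → a * 1ℚ + b * 0ℚ ≡ a
    simplify = solve-∀ ringℚ

  embed-full : full {m} ≢ ∅ → ∀ p → embed p full ≡ proj₂ p
  embed-full full≢∅ (a , b) = trans (cong₂ (λ x y → a * x + b * y) (γ-diff full≢∅) (γ-same (full {m}))) (simplify a b)
    where
    simplify : ∀ a b → a * 0ℚ + b * 1ℚ ≡ b
    simplify = solve-∀ ringℚ

  embed-scalar : ∀ a → embed (a , 0ℚ) (∅ {m}) ≡ a
  embed-scalar a = trans (cong (λ x → a * x + 0ℚ * γ full (∅ {m})) (γ-same (∅ {m}))) (simplify a (γ full (∅ {m})))
    where
    simplify : ∀ a y → a * 1ℚ + 0ℚ * y ≡ a
    simplify = solve-∀ ringℚ

  embed-elsewhere : ∀ p {U} → U ≢ ∅ → U ≢ full → embed p U ≡ 0ℚ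
  embed-elsewhere (a , b) U≢∅ U≢full = trans (cong₂ (λ x y → a * x + b * y) (γ-diff U≢∅) (γ-diff U≢full)) (simplify a b)
    where
    simplify : ∀ a b → a * 0ℚ + b * 0ℚ ≡ 0ℚ
    simplify = solve-∀ ringℚ

-- The denominator bound
isInteger-∣ : ∀ {n N q} → n ∣ N → IsInteger (ι (+ n) * q) → IsInteger (ι (+ N) * q)
isInteger-∣ {n} {q = q} (divides k refl) nq∈ℤ = isInteger-resp (begin
  ι (+ k) * (ι (+ n) * q)      ≡⟨ ℚP.*-assoc (ι (+ k)) (ι (+ n)) q ⟨
  (ι (+ k) * ι (+ n)) * q      ≡⟨ cong (_* q) (ι-homo-* (+ k) (+ n)) ⟨
  ι (+ k ℤ.* + n) * q          ≡⟨ cong (λ i → ι i * q) (ℤP.pos-* k n) ⟨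
  ι (+ (k ℕ.* n)) * q          ∎) (isInteger-* (+ k , refl) nq∈ℤ)
  where open ≡-Reasoning

isInteger-∣∣ : ∀ c {q} → IsInteger (ι c * q) → IsInteger (ι (+ ℤ.∣ c ∣) * q)
isInteger-∣∣ (+ n) cq∈ℤ = cq∈ℤ
isInteger-∣∣ c@(-[1+ n ]) {q} cq∈ℤ = isInteger-resp
  (trans (ℚP.neg-distribˡ-* (ι c) q) (cong (_* q) (sym (ι-homo‿- c)))) (isInteger-‿ cq∈ℤ)

module _ {m : ℕ} where

  BoundedBy : ℕ → Pred {m}
  BoundedBy D x = ∀ S → IsInteger (ι (+ D) * x S)

  BoundedBy-isSubmodule : ∀ D → IsSubmodule (BoundedBy D)
  BoundedBy-isSubmodule D = record
    { resp-≈ = λ x≈y x∈ S → isInteger-resp (cong (ι (+ D) *_) (x≈y S)) (x∈ S)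
    ; 0∈ = λ S → isInteger-resp (sym (ℚP.*-zeroʳ (ι (+ D)))) (+ 0 , refl)
    ; +-closed = λ {x} {y} x∈ y∈ S → isInteger-resp (sym (ℚP.*-distribˡ-+ (ι (+ D)) (x S) (y S))) (isInteger-+ (x∈ S) (y∈ S))
    ; ℤ·-closed = λ c {x} x∈ S → isInteger-resp (swap (ι c) (ι (+ D)) (x S)) (isInteger-* (c , refl) (x∈ S)) }
    where
    swap : ∀ a b x → a * (b * x) ≡ b * (a * x)
    swap = solve-∀ ringℚ

  denominator : Clf m → ℕ
  denominator x = product (map (↧ₙ_ ∘ x) (allSubsets m))

  denominator-clears : ∀ x → BoundedBy (denominator x) x
  denominator-clears x S = isInteger-∣ (∈⇒∣product (∈-map⁺ (↧ₙ_ ∘ x) (allSubsets-complete S)))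
    (↥ (x S) , trans (ℚP.*-comm _ (x S)) (q*↧q≡↥q (x S)))

  commonDenominator : ∀ k → (Fin k → Clf m) → ℕ
  commonDenominator k g = product (map (denominator ∘ g) (allFin k))

  ZSpan-bounded : ∀ k g → ZSpan (k , g) ⊆ BoundedBy (commonDenominator k g)
  ZSpan-bounded k g = ZSpan-least (BoundedBy-isSubmodule (commonDenominator k g)) k g λ i S →
    isInteger-∣ (∈⇒∣product (∈-map⁺ (denominator ∘ g) (∈-allFin i))) (denominator-clears (g i) S)

  denominator≢0 : ∀ x → ℕ.NonZero (denominator x)
  denominator≢0 x = product≢0 (AllP.map⁺ (all-nonZero (allSubsets m)))
    where
    all-nonZero : ∀ Ss → All (ℕ.NonZero ∘ ↧ₙ_ ∘ x) Ss
    all-nonZero _ = All.tabulate λ _ → _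

  commonDenominator≢0 : ∀ k g → ℕ.NonZero (commonDenominator k g)
  commonDenominator≢0 k g = product≢0 (AllP.map⁺ (all-nonZero (allFin k)))
    where
    all-nonZero : ∀ is → All (ℕ.NonZero ∘ denominator ∘ g) is
    all-nonZero _ = All.tabulate λ {i} _ → denominator≢0 (g i)

module _ {m : ℕ} (d : Vec ℤ m) where

  averageAll : Clf m → Clf m
  averageAll = averageOver d (allFin m)

  averageAll-vanishes : ∀ z {U} → U ≢ ∅ → (U ≡ full → sgn m ≡ + 1) → averageAll z U ≡ 0ℚ
  averageAll-vanishes z {U} U≢∅ full⇒even with anticommuting-generator U U≢∅ full⇒even
  ... | i , σ≡-1 = begin
    averageAll z U                                   ≡⟨ averageOver-coord d (allFin m) z U ⟩
    ι (averageFactors d (allFin m) U) * z U          ≡⟨ cong (λ k → ι k * z U) (averageFactors-vanish d (allFin m) U (∈-allFin i) σ≡-1) ⟩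
    0ℚ * z U                                         ≡⟨ ℚP.*-zeroˡ (z U) ⟩
    0ℚ                                               ∎
    where open ≡-Reasoning

  traceFactor : Subset m → ℤ
  traceFactor S = (+ 2 ℤ.* averageFactors d (allFin m) ∅) ℤ.* basisCoeff d S S

  traceFactor≢0 : Nondegenerate d → ∀ S → traceFactor S ≢ + 0
  traceFactor≢0 nd S = *-≢0 (*-≢0 {+ 2} (λ ()) (averageFactors-∅≢0 d nd (allFin m))) (basisCoeff-self≢0 d nd S)

  module _ {O : Pred {m}} (O-order : IsOrder d O) (Λ⊆O : CliffordOrder ⊆ O) where

    open IsOrder O-order
    open IsSubmodule (IsOrder⇒IsSubmodule O-order)
    open QuadraticAlgebra (basisCoeff d full full) using (_^ᵠ_; ^ᵠ-real; bounded; trace-isInteger)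

    private
      D : ℕ
      D = commonDenominator (proj₁ (proj₁ finGen)) (proj₂ (proj₁ finGen))

      instance
        D≢0 : ℕ.NonZero D
        D≢0 = commonDenominator≢0 (proj₁ (proj₁ finGen)) (proj₂ (proj₁ finGen))

    O-bounded : O ⊆ BoundedBy D
    O-bounded x x∈O = ZSpan-bounded _ _ x (proj₁ (proj₂ finGen) x x∈O)

    averageAll∈O : ∀ z → O z → O (averageAll z)
    averageAll∈O z z∈O = average-all (allFin m)
      where
      γᵢ∈O : ∀ i → O (γ ⁅ i ⁆)
      γᵢ∈O i = Λ⊆O _ (γ∈CliffordOrder ⁅ i ⁆)
      average-all : ∀ is → O (averageOver d is z)
      average-all [] = z∈O
      average-all (i ∷ is) = +-closed (ℤ·-closed (lookup d i) (average-all is))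
        (neg _ (mul _ _ (mul _ _ (γᵢ∈O i) (average-all is)) (γᵢ∈O i)))

    powC∈O : ∀ y → O y → ∀ k → O (powC d y k)
    powC∈O y y∈O zero = one
    powC∈O y y∈O (suc k) = mul _ _ y∈O (powC∈O y y∈O k)

    twice-scalarPart-even : sgn m ≡ + 1 → ∀ z → O z → IsInteger (averageAll z ∅ + averageAll z ∅)
    twice-scalarPart-even even z z∈O = isInteger-+ scalar∈ℤ scalar∈ℤ
      where
      y = averageAll z
      y≈scalar : y ≈ embed d (y ∅ , 0ℚ)
      y≈scalar U = by-cases (U ≟ˢ ∅)
        where
        simplify : ∀ a b → a * 0ℚ + 0ℚ * b ≡ 0ℚ
        simplify = solve-∀ ringℚ
        by-cases : Dec (U ≡ ∅) → y U ≡ embed d (y ∅ , 0ℚ) U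
        by-cases (yes refl) = sym (embed-scalar d (y ∅))
        by-cases (no U≢∅) = trans (averageAll-vanishes z U≢∅ (λ _ → even))
          (sym (trans (cong (λ x → y ∅ * x + 0ℚ * γ full U) (γ-diff U≢∅)) (simplify (y ∅) (γ full U))))
      scalar∈ℤ : IsInteger (y ∅)
      scalar∈ℤ = bounded-powers⇒isInteger D (y ∅) λ k → isInteger-resp
        (cong (ι (+ D) *_) (trans (powC-embed d (y ∅ , 0ℚ) y≈scalar k ∅)
          (trans (cong (λ p → embed d p ∅) (^ᵠ-real (y ∅) k)) (embed-scalar d (y ∅ ^ k)))))
        (O-bounded _ (powC∈O y (averageAll∈O z z∈O) k) ∅)

    twice-scalarPart-odd : sgn m ≡ -[1+ 0 ] → ∀ z → O z → IsInteger (averageAll z ∅ + averageAll z ∅)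
    twice-scalarPart-odd odd z z∈O = trace-isInteger D u λ k → bounded
        (isInteger-resp (cong (ι (+ D) *_) (trans (powC-embed d u y≈u k ∅) (embed-∅ d full≢∅ (u ^ᵠ k)))) (yᵏ-bounded k ∅))
        (isInteger-resp (cong (ι (+ D) *_) (trans (powC-embed d u y≈u k full) (embed-full d full≢∅ (u ^ᵠ k)))) (yᵏ-bounded k full))
      where
      y = averageAll z
      u = (y ∅ , y full)
      full≢∅ : full {m} ≢ ∅
      full≢∅ full≡∅ = +1≢-1 (trans (cong sgn (sym (trans (sym (card-full m)) (trans (cong card full≡∅) (card-∅ m))))) odd)
        where
        +1≢-1 : + 1 ≢ -[1+ 0 ]
        +1≢-1 ()
      y≈u : y ≈ embed d u
      y≈u U = by-cases (U ≟ˢ ∅) (U ≟ˢ full)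
        where
        by-cases : Dec (U ≡ ∅) → Dec (U ≡ full) → y U ≡ embed d u U
        by-cases (yes refl) _ = sym (embed-∅ d full≢∅ u)
        by-cases (no _) (yes refl) = sym (embed-full d full≢∅ u)
        by-cases (no U≢∅) (no U≢full) = trans (averageAll-vanishes z U≢∅ (⊥-elim ∘ U≢full)) (sym (embed-elsewhere d u U≢∅ U≢full))
      yᵏ-bounded : ∀ k → BoundedBy D (powC d y k)
      yᵏ-bounded k = O-bounded _ (powC∈O y (averageAll∈O z z∈O) k)

    -- The averaged element lies in ℚ·1 (m even) or in ℚ·1 + ℚ·γ_full (m odd), and is integral
    -- over ℤ since its powers stay in O; hence its "trace" 2 y_∅ is an integer.
    twice-scalarPart : ∀ z → O z → IsInteger (averageAll z ∅ + averageAll z ∅)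
    twice-scalarPart = [ twice-scalarPart-even , twice-scalarPart-odd ]′ (sgn-±1 m)

    traceFactor-clears : ∀ x → O x → ∀ S → IsInteger (ι (traceFactor S) * x S)
    traceFactor-clears x x∈O S = isInteger-resp y∅+y∅≡ (twice-scalarPart z (mul _ _ x∈O (Λ⊆O _ (γ∈CliffordOrder S))))
      where
      z = mulC d x (γ S)
      P₀ = averageFactors d (allFin m) ∅
      z∅≡ : z ∅ ≡ ι (basisCoeff d S S) * x S
      z∅≡ = trans (mulC-γʳ d x S ∅) (cong (λ V → ι (basisCoeff d V S) * x V) (⊕-identityˡ S))
      y∅+y∅≡ : averageAll z ∅ + averageAll z ∅ ≡ ι (traceFactor S) * x S
      y∅+y∅≡ = begin
        averageAll z ∅ + averageAll z ∅
          ≡⟨ cong (λ w → w + w) (trans (averageOver-coord d (allFin m) z ∅) (cong (ι P₀ *_) z∅≡)) ⟩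
        ι P₀ * (ι (basisCoeff d S S) * x S) + ι P₀ * (ι (basisCoeff d S S) * x S)
          ≡⟨ double (ι P₀) (ι (basisCoeff d S S)) (x S) ⟩
        ((ι (+ 1) + ι (+ 1)) * ι P₀) * ι (basisCoeff d S S) * x S
          ≡⟨ cong (λ t → t * x S) (trans (cong (λ t → (t * ι P₀) * ι (basisCoeff d S S)) (sym (ι-homo-+ (+ 1) (+ 1))))
               (trans (cong (_* ι (basisCoeff d S S)) (sym (ι-homo-* (+ 2) P₀))) (sym (ι-homo-* (+ 2 ℤ.* P₀) (basisCoeff d S S))))) ⟩
        ι (traceFactor S) * x S ∎
        where
        open ≡-Reasoning
        double : ∀ p k x → p * (k * x) + p * (k * x) ≡ ((ι (+ 1) + ι (+ 1)) * p) * k * x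
        double = solve-∀ ringℚ

module _ {m : ℕ} (d : Vec ℤ m) where

  cliffordDenominator : ℕ
  cliffordDenominator = product (map (ℤ.∣_∣ ∘ traceFactor d) (allSubsets m))

  cliffordDenominator≢0 : Nondegenerate d → ℕ.NonZero cliffordDenominator
  cliffordDenominator≢0 nd = product≢0 (AllP.map⁺ (all-nonZero (allSubsets m)))
    where
    all-nonZero : ∀ Ss → All (ℕ.NonZero ∘ ℤ.∣_∣ ∘ traceFactor d) Ss
    all-nonZero _ = All.tabulate λ {S} _ → ℕ.≢-nonZero (traceFactor≢0 d nd S ∘ ℤP.∣i∣≡0⇒i≡0)

  denominator-bound : ∀ {O} → IsOrder d O → CliffordOrder ⊆ O → O ⊆ BoundedBy cliffordDenominator
  denominator-bound O-order Λ⊆O x x∈O S = isInteger-∣ (∈⇒∣product (∈-map⁺ (ℤ.∣_∣ ∘ traceFactor d) (allSubsets-complete S)))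
    (isInteger-∣∣ (traceFactor d S) (traceFactor-clears d O-order Λ⊆O x x∈O S))

-- Enumerating the orders containing the Clifford order
module _ {A : Set} where

  sublists : List A → List (List A)
  sublists [] = [] ∷ []
  sublists (x ∷ xs) = map (x ∷_) (sublists xs) ++ sublists xs

  filter∈sublists : ∀ {P : A → Set} (P? : Decidable P) xs → filter P? xs ∈ sublists xs
  filter∈sublists P? [] = here refl
  filter∈sublists P? (x ∷ xs) with does (P? x)
  ... | true = ∈-++⁺ˡ (∈-map⁺ (x ∷_) (filter∈sublists P? xs))
  ... | false = ∈-++⁺ʳ (map (x ∷_) (sublists xs)) (filter∈sublists P? xs)

  vectors : List A → ∀ k → List (Vec A k)
  vectors xs zero = [] ∷ []
  vectors xs (suc k) = concatMap (λ a → map (a ∷_) (vectors xs k)) xs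

  vectors-complete : ∀ {xs} → (∀ a → a ∈ xs) → ∀ {k} (v : Vec A k) → v ∈ vectors xs k
  vectors-complete xs-complete [] = here refl
  vectors-complete {xs} xs-complete {suc k} (a ∷ v) =
    ∈-concatMap⁺ (λ b → map (b ∷_) (vectors xs k)) (Any.map (λ { refl → ∈-map⁺ (a ∷_) (vectors-complete xs-complete v) }) (xs-complete a))

module _ {m : ℕ} where

  infixr 5 _++ᴳ_
  _++ᴳ_ : Gens {m} → Gens {m} → Gens {m}
  (k , g) ++ᴳ (k′ , g′) = k ℕ.+ k′ , λ i → [ g , g′ ]′ (splitAt k i)

  sumC-++ : ∀ k k′ (f : Fin (k ℕ.+ k′) → Clf m) →
    sumC (k ℕ.+ k′) f ≈ (sumC k (λ i → f (i ↑ˡ k′)) +C sumC k′ (λ i → f (k ↑ʳ i)))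
  sumC-++ zero k′ f S = sym (ℚP.+-identityˡ _)
  sumC-++ (suc k) k′ f S = trans (cong (_+_ (f zero S)) (sumC-++ k k′ (λ i → f (suc i)) S)) (sym (ℚP.+-assoc (f zero S) _ _))

  private
    ++ᴳ-↑ˡ : ∀ k k′ (g : Fin k → Clf m) (g′ : Fin k′ → Clf m) i → [ g , g′ ]′ (splitAt k (i ↑ˡ k′)) ≡ g i
    ++ᴳ-↑ˡ k k′ g g′ i = cong [ g , g′ ]′ (FinP.splitAt-↑ˡ k i k′)

    ++ᴳ-↑ʳ : ∀ k k′ (g : Fin k → Clf m) (g′ : Fin k′ → Clf m) i → [ g , g′ ]′ (splitAt k (k ↑ʳ i)) ≡ g′ i
    ++ᴳ-↑ʳ k k′ g g′ i = cong [ g , g′ ]′ (FinP.splitAt-↑ʳ k k′ i)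

  ZSpan-++⁺ˡ : ∀ G G′ → ZSpan G ⊆ ZSpan (G ++ᴳ G′)
  ZSpan-++⁺ˡ (k , g) (k′ , g′) = ZSpan-least (ZSpan-isSubmodule _) k g λ i →
    IsSubmodule.resp-≈ (ZSpan-isSubmodule _) (λ S → cong (λ h → h S) (++ᴳ-↑ˡ k k′ g g′ i)) (generator∈ZSpan _ _ (i ↑ˡ k′))

  ZSpan-++⁺ʳ : ∀ G G′ → ZSpan G′ ⊆ ZSpan (G ++ᴳ G′)
  ZSpan-++⁺ʳ (k , g) (k′ , g′) = ZSpan-least (ZSpan-isSubmodule _) k′ g′ λ i →
    IsSubmodule.resp-≈ (ZSpan-isSubmodule _) (λ S → cong (λ h → h S) (++ᴳ-↑ʳ k k′ g g′ i)) (generator∈ZSpan _ _ (k ↑ʳ i))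

  ZSpan-++⁻ : ∀ k (g : Fin k → Clf m) k′ (g′ : Fin k′ → Clf m) {x} → ZSpan ((k , g) ++ᴳ (k′ , g′)) x →
    Σ (Fin k → ℤ) λ c → Σ (Fin k′ → ℤ) λ c′ → x ≈ (sumC k (λ i → ι (c i) ·C g i) +C sumC k′ (λ i → ι (c′ i) ·C g′ i))
  ZSpan-++⁻ k g k′ g′ (c , x≈∑) = (λ i → c (i ↑ˡ k′)) , (λ i → c (k ↑ʳ i)) ,
    ≈-trans x≈∑ (≈-trans (sumC-++ k k′ _) λ S → cong₂ _+_
      (sumC-cong k (λ i S′ → cong (λ h → ι (c (i ↑ˡ k′)) * h S′) (++ᴳ-↑ˡ k k′ g g′ i)) S)
      (sumC-cong k′ (λ i S′ → cong (λ h → ι (c (k ↑ʳ i)) * h S′) (++ᴳ-↑ʳ k k′ g g′ i)) S))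

module Fractions {m : ℕ} (N : ℕ) .{{N≢0 : ℕ.NonZero N}} where

  reduce : ℤ → Fin N
  reduce w = fromℕ< (n%ℕd<d w N)

  reduce-divMod : ∀ w → w ≡ + toℕ (reduce w) ℤ.+ (w /ℕ N) ℤ.* + N
  reduce-divMod w = trans (a≡a%ℕn+[a/ℕn]*n w N) (cong (λ r → + r ℤ.+ (w /ℕ N) ℤ.* + N) (sym (FinP.toℕ-fromℕ< _)))

  ι-*-reduce : ∀ c a → ι c * a ≡ ι (+ toℕ (reduce c)) * a + ι (c /ℕ N) * (ι (+ N) * a)
  ι-*-reduce c a = begin
    ι c * a                                                ≡⟨ cong (λ w → ι w * a) (reduce-divMod c) ⟩
    ι (+ toℕ (reduce c) ℤ.+ (c /ℕ N) ℤ.* + N) * a           ≡⟨ cong (_* a) (ι-homo-+ (+ toℕ (reduce c)) ((c /ℕ N) ℤ.* + N)) ⟩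
    (ι (+ toℕ (reduce c)) + ι ((c /ℕ N) ℤ.* + N)) * a       ≡⟨ cong (λ t → (ι (+ toℕ (reduce c)) + t) * a) (ι-homo-* (c /ℕ N) (+ N)) ⟩
    (ι (+ toℕ (reduce c)) + ι (c /ℕ N) * ι (+ N)) * a       ≡⟨ distrib (ι (+ toℕ (reduce c))) (ι (c /ℕ N)) (ι (+ N)) a ⟩
    ι (+ toℕ (reduce c)) * a + ι (c /ℕ N) * (ι (+ N) * a)   ∎
    where
    open ≡-Reasoning
    distrib : ∀ r q n f → (r + q * n) * f ≡ r * f + q * (n * f)
    distrib = solve-∀ ringℚ

  private
    instance
      Nℚ≢0 : ℚ.NonZero (ι (+ N))
      Nℚ≢0 = ℚ.≢-nonZero λ Nℚ≡0 → ℕ.≢-nonZero⁻¹ N (ℤP.+-injective (ι-injective Nℚ≡0))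

  1/N : ℚ
  1/N = ℚ.1/ ι (+ N)

  N*1/N : ι (+ N) * 1/N ≡ 1ℚ
  N*1/N = ℚP.*-inverseʳ (ι (+ N))

  Residue : Set
  Residue = Vec (Fin N) (length (allSubsets m))

  position : Subset m → Fin (length (allSubsets m))
  position S = Any.index (allSubsets-complete S)

  -- r represents the element Σ_S (r_S / N) γ_S, with r_S ∈ {0, …, N-1}.
  fraction : Residue → Clf m
  fraction r S = ι (+ toℕ (Vec.lookup r (position S))) * 1/N

  N·fraction∈Λ : ∀ r → CliffordOrder (ι (+ N) ·C fraction r)
  N·fraction∈Λ r S = + toℕ (Vec.lookup r (position S)) , cancel (ι (+ toℕ (Vec.lookup r (position S))))
    where
    cancel : ∀ a → ι (+ N) * (a * 1/N) ≡ a
    cancel a = trans (swap (ι (+ N)) a 1/N) (trans (cong (a *_) N*1/N) (ℚP.*-identityʳ a))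
      where
      swap : ∀ n a i → n * (a * i) ≡ a * (n * i)
      swap = solve-∀ ringℚ

  residue : (x : Clf m) → BoundedBy N x → Residue
  residue x N·x∈ℤ = tabulate λ j → reduce (proj₁ (N·x∈ℤ (List.lookup (allSubsets m) j)))

  integralPart∈Λ : ∀ x (N·x∈ℤ : BoundedBy N x) → CliffordOrder (x +C (-C fraction (residue x N·x∈ℤ)))
  integralPart∈Λ x N·x∈ℤ S = q , (begin
    x S + - (ι (+ toℕ (Vec.lookup (residue x N·x∈ℤ) (position S))) * 1/N)
      ≡⟨ cong₂ (λ a r → a + - (ι (+ toℕ r) * 1/N)) x≡w/N lookup-residue ⟩
    1/N * ι w + - (ι (+ toℕ (reduce w)) * 1/N)
      ≡⟨ cong (λ v → 1/N * v + - (ι (+ toℕ (reduce w)) * 1/N)) (trans (cong ι (reduce-divMod w))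
           (trans (ι-homo-+ (+ toℕ (reduce w)) (q ℤ.* + N)) (cong (_+_ (ι (+ toℕ (reduce w)))) (ι-homo-* q (+ N))))) ⟩
    1/N * (ι (+ toℕ (reduce w)) + ι q * ι (+ N)) + - (ι (+ toℕ (reduce w)) * 1/N)
      ≡⟨ rearrange 1/N (ι (+ toℕ (reduce w))) (ι q) (ι (+ N)) ⟩
    ι q * (ι (+ N) * 1/N)
      ≡⟨ trans (cong (ι q *_) N*1/N) (ℚP.*-identityʳ (ι q)) ⟩
    ι q ∎)
    where
    open ≡-Reasoning
    w = proj₁ (N·x∈ℤ S)
    q = w /ℕ N
    x≡w/N : x S ≡ 1/N * ι w
    x≡w/N = begin
      x S                          ≡⟨ ℚP.*-identityˡ (x S) ⟨
      1ℚ * x S                     ≡⟨ cong (_* x S) (trans (ℚP.*-comm 1/N (ι (+ N))) N*1/N) ⟨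
      (1/N * ι (+ N)) * x S        ≡⟨ ℚP.*-assoc 1/N (ι (+ N)) (x S) ⟩
      1/N * (ι (+ N) * x S)        ≡⟨ cong (1/N *_) (proj₂ (N·x∈ℤ S)) ⟩
      1/N * ι w                    ∎
    lookup-residue : Vec.lookup (residue x N·x∈ℤ) (position S) ≡ reduce w
    lookup-residue = trans (VecP.lookup∘tabulate _ (position S))
      (cong (reduce ∘ proj₁ ∘ N·x∈ℤ) (sym (AnyP.lookup-index (allSubsets-complete S))))
    rearrange : ∀ i r q n → i * (r + q * n) + - (r * i) ≡ q * (n * i)
    rearrange = solve-∀ ringℚ

module Candidates {m : ℕ} (d : Vec ℤ m) (N : ℕ) .{{N≢0 : ℕ.NonZero N}} where

  open Fractions {m} N

  Candidate : Set
  Candidate = List Residue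

  fractionGens : Candidate → Gens {m}
  fractionGens B = length B , λ i → fraction (List.lookup B i)

  candidateGens : Candidate → Gens {m}
  candidateGens B = basisGens ++ᴳ fractionGens B

  ⟦_⟧ : Candidate → Pred {m}
  ⟦ B ⟧ = ZSpan (candidateGens B)

  ⟦⟧-isSubmodule : ∀ B → IsSubmodule ⟦ B ⟧
  ⟦⟧-isSubmodule B = ZSpan-isSubmodule (candidateGens B)

  Λ⊆⟦⟧ : ∀ B → CliffordOrder ⊆ ⟦ B ⟧
  Λ⊆⟦⟧ B x x∈Λ = ZSpan-++⁺ˡ basisGens (fractionGens B) x (CliffordOrder⊆ZSpan-basis x x∈Λ)

  fraction∈⟦⟧ : ∀ B i → ⟦ B ⟧ (fraction (List.lookup B i))
  fraction∈⟦⟧ B i = ZSpan-++⁺ʳ basisGens (fractionGens B) _ (generator∈ZSpan _ _ i)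

  combination : (B : Candidate) → Vec (Fin N) (length B) → Clf m
  combination B v = sumC (length B) (λ i → ι (+ toℕ (Vec.lookup v i)) ·C fraction (List.lookup B i))

  -- Only the residues mod N of the coefficients of the fractions matter, so membership is a finite search.
  Member : Candidate → Clf m → Set
  Member B x = Any (λ v → CliffordOrder (x +C (-C combination B v))) (vectors (allFin N) (length B))

  member? : ∀ B → Decidable (Member B)
  member? B x = Any.any? (λ v → CliffordOrder? (x +C (-C combination B v))) (vectors (allFin N) (length B))

  member-sound : ∀ B {x} → Member B x → ⟦ B ⟧ x
  member-sound B {x} x∈ with Any.satisfied x∈
  ... | v , x-comb∈Λ = resp-≈ (λ S → cancel (x S) (combination B v S))
    (+-closed (Λ⊆⟦⟧ B _ x-comb∈Λ) (ZSpan-++⁺ʳ basisGens (fractionGens B) _ ((λ i → + toℕ (Vec.lookup v i)) , ≈-refl)))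
    where
    open IsSubmodule (⟦⟧-isSubmodule B)
    cancel : ∀ a b → (a + - b) + b ≡ a
    cancel = solve-∀ ringℚ

  member-complete : ∀ B {x} → ⟦ B ⟧ x → Member B x
  member-complete B {x} x∈ with ZSpan-++⁻ _ _ _ _ x∈
  ... | c , c′ , x≈basis+fractions =
    Any.map (λ { refl → x-comb∈Λ }) (vectors-complete ∈-allFin v)
    where
    open IsSubmodule CliffordOrder-isSubmodule
    k = length B
    frac : Fin k → Clf m
    frac i = fraction (List.lookup B i)
    v : Vec (Fin N) k
    v = tabulate (reduce ∘ c′)
    q : Fin k → ℤ
    q i = c′ i /ℕ N
    basisPart = sumC _ (λ i → ι (c i) ·C γ (List.lookup (allSubsets m) i))
    multiplesOfN = sumC k (λ i → ι (q i) ·C (ι (+ N) ·C frac i))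

    termwise : ∀ i S → ι (c′ i) * frac i S ≡ ι (+ toℕ (Vec.lookup v i)) * frac i S + ι (q i) * (ι (+ N) * frac i S)
    termwise i S = trans (ι-*-reduce (c′ i) (frac i S))
      (cong (λ r → ι (+ toℕ r) * frac i S + ι (q i) * (ι (+ N) * frac i S)) (sym (VecP.lookup∘tabulate (reduce ∘ c′) i)))

    fractions≈ : sumC k (λ i → ι (c′ i) ·C frac i) ≈ (combination B v +C multiplesOfN)
    fractions≈ = ≈-trans (sumC-cong k termwise) (≈-sym (sumC-+ k _ _))

    x-comb∈Λ : CliffordOrder (x +C (-C combination B v))
    x-comb∈Λ = resp-≈ (λ S → sym (trans (cong (_+ - combination B v S) (trans (x≈basis+fractions S) (cong (_+_ (basisPart S)) (fractions≈ S))))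
                                         (cancel (basisPart S) (combination B v S) (multiplesOfN S))))
      (+-closed (ZSpan-basis⊆CliffordOrder basisPart (c , ≈-refl))
                (combination-closed CliffordOrder-isSubmodule k _ (λ i → N·fraction∈Λ (List.lookup B i)) q))
      where
      cancel : ∀ a b e → (a + (b + e)) + - b ≡ a + e
      cancel = solve-∀ ringℚ

  private
    gen : ∀ B → Fin (proj₁ (candidateGens B)) → Clf m
    gen B = proj₂ (candidateGens B)

  IsOrderCandidate : Candidate → Set
  IsOrderCandidate B = ∀ i j → Member B (mulC d (gen B i) (gen B j))

  isOrderCandidate? : Decidable IsOrderCandidate
  isOrderCandidate? B = FinP.all? λ i → FinP.all? λ j → member? B (mulC d (gen B i) (gen B j))

  IsOrderCandidate⇒IsOrder : ∀ {B} → IsOrderCandidate B → IsOrder d ⟦ B ⟧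
  IsOrderCandidate⇒IsOrder {B} closed = record
    { one = Λ⊆⟦⟧ B 1C λ S → isInteger-resp (sym (1C≈γ∅ S)) (γ∈CliffordOrder _ S)
    ; add = λ _ _ → +-closed
    ; neg = λ _ → -C-closed (⟦⟧-isSubmodule B)
    ; mul = ZSpan-mulClosed d _ (gen B) (λ i j → member-sound B (closed i j))
    ; finGen = candidateGens B , (λ _ x∈ → x∈) , (λ _ x∈ → x∈)
    ; spans = λ x → length (allSubsets m) , γ ∘ List.lookup (allSubsets m) ,
        (λ i → Λ⊆⟦⟧ B _ (γ∈CliffordOrder _)) , x ∘ List.lookup (allSubsets m) , ≈-sym (sumC-basis x) }
    where open IsSubmodule (⟦⟧-isSubmodule B)

  IsOrder⇒IsOrderCandidate : ∀ {B} → IsOrder d ⟦ B ⟧ → IsOrderCandidate B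
  IsOrder⇒IsOrderCandidate {B} order i j =
    member-complete B (IsOrder.mul order _ _ (generator∈ZSpan _ (gen B) i) (generator∈ZSpan _ (gen B) j))

  _≼_ : Candidate → Candidate → Set
  B ≼ B′ = ∀ i → Member B′ (fraction (List.lookup B i))

  _≼?_ : ∀ B B′ → Dec (B ≼ B′)
  B ≼? B′ = FinP.all? λ i → member? B′ (fraction (List.lookup B i))

  ≼⇒⊆ : ∀ {B B′} → B ≼ B′ → ⟦ B ⟧ ⊆ ⟦ B′ ⟧
  ≼⇒⊆ {B} {B′} B≼B′ = ZSpan-least (⟦⟧-isSubmodule B′) _ (gen B) (λ i → gen∈ (Fin.splitAt (length (allSubsets m)) i))
    where
    gen∈ : ∀ s → ⟦ B′ ⟧ ([ γ ∘ List.lookup (allSubsets m) , fraction ∘ List.lookup B ]′ s)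
    gen∈ (inj₁ j) = Λ⊆⟦⟧ B′ _ (γ∈CliffordOrder _)
    gen∈ (inj₂ j) = member-sound B′ (B≼B′ j)

  ⊆⇒≼ : ∀ {B B′} → ⟦ B ⟧ ⊆ ⟦ B′ ⟧ → B ≼ B′
  ⊆⇒≼ {B} {B′} B⊆B′ i = member-complete B′ (B⊆B′ _ (fraction∈⟦⟧ B i))

module Algorithm {m : ℕ} (d : Vec ℤ m) (nd : Nondegenerate d) where

  private
    N : ℕ
    N = cliffordDenominator d

    instance
      N≢0 : ℕ.NonZero N
      N≢0 = cliffordDenominator≢0 d nd

  open Fractions {m} N
  open Candidates d N

  allResidues : List Residue
  allResidues = vectors (allFin N) (length (allSubsets m))

  allCandidates : List Candidate
  allCandidates = sublists allResidues

  module _ {O : Pred {m}} (O-order : IsOrder d O) (Λ⊆O : CliffordOrder ⊆ O) where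

    open IsOrder O-order

    private
      k = proj₁ (proj₁ finGen)
      g = proj₂ (proj₁ finGen)
      O-sub = IsOrder⇒IsSubmodule O-order

      g∈O : ∀ j → O (g j)
      g∈O j = proj₂ (proj₂ finGen) _ (generator∈ZSpan k g j)

      g-bounded : ∀ j → BoundedBy N (g j)
      g-bounded j = denominator-bound d O-order Λ⊆O (g j) (g∈O j)

      residueOf : Fin k → Residue
      residueOf j = residue (g j) (g-bounded j)

      residueOfGenerator? : Decidable (λ r → ∃ λ j → residueOf j ≡ r)
      residueOfGenerator? r = FinP.any? λ j → VecP.≡-dec FinP._≟_ (residueOf j) r

      fraction∈O : ∀ j → O (fraction (residueOf j))
      fraction∈O j = IsSubmodule.resp-≈ O-sub (λ S → cancel (g j S) (fraction (residueOf j) S))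
        (IsSubmodule.+-closed O-sub (g∈O j) (-C-closed O-sub (Λ⊆O _ (integralPart∈Λ (g j) (g-bounded j)))))
        where
        cancel : ∀ a b → a + - (a + - b) ≡ b
        cancel = solve-∀ ringℚ

    -- Each generator of O is its fractional part plus an element of Λ.
    generatorResidues : Candidate
    generatorResidues = filter residueOfGenerator? allResidues

    generatorResidues∈allCandidates : generatorResidues ∈ allCandidates
    generatorResidues∈allCandidates = filter∈sublists residueOfGenerator? allResidues

    O⊆⟦generatorResidues⟧ : O ⊆ ⟦ generatorResidues ⟧
    O⊆⟦generatorResidues⟧ x x∈O = ZSpan-least (⟦⟧-isSubmodule B) k g g∈⟦B⟧ x (proj₁ (proj₂ finGen) x x∈O)
      where
      B = generatorResidues
      g∈⟦B⟧ : ∀ j → ⟦ B ⟧ (g j)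
      g∈⟦B⟧ j = IsSubmodule.resp-≈ (⟦⟧-isSubmodule B) (λ S → cancel (g j S) (fraction (residueOf j) S))
        (IsSubmodule.+-closed (⟦⟧-isSubmodule B) (Λ⊆⟦⟧ B _ (integralPart∈Λ (g j) (g-bounded j))) fraction∈⟦B⟧)
        where
        cancel : ∀ a b → (a + - b) + b ≡ a
        cancel = solve-∀ ringℚ
        residue∈B : residueOf j ∈ B
        residue∈B = ∈-filter⁺ residueOfGenerator? {xs = allResidues} (vectors-complete ∈-allFin (residueOf j)) (j , refl)
        fraction∈⟦B⟧ : ⟦ B ⟧ (fraction (residueOf j))
        fraction∈⟦B⟧ = subst (⟦ B ⟧ ∘ fraction) (sym (AnyP.lookup-index residue∈B)) (fraction∈⟦⟧ B (Any.index residue∈B))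

    ⟦generatorResidues⟧⊆O : ⟦ generatorResidues ⟧ ⊆ O
    ⟦generatorResidues⟧⊆O = ZSpan-least O-sub _ _ (λ i → gen∈O (Fin.splitAt (length (allSubsets m)) i))
      where
      B = generatorResidues
      gen∈O : ∀ s → O ([ γ ∘ List.lookup (allSubsets m) , fraction ∘ List.lookup B ]′ s)
      gen∈O (inj₁ _) = Λ⊆O _ (γ∈CliffordOrder _)
      gen∈O (inj₂ i) = fromGenerator (proj₂ (∈-filter⁻ residueOfGenerator? {xs = allResidues} (∈-lookup {xs = B} i)))
        where
        fromGenerator : ∃ (λ j → residueOf j ≡ List.lookup B i) → O (fraction (List.lookup B i))
        fromGenerator (j , residueOf-j≡) = subst (O ∘ fraction) residueOf-j≡ (fraction∈O j)

  order-as-candidate : ∀ {O} → IsOrder d O → CliffordOrder ⊆ O → Σ Candidate λ B → B ∈ allCandidates × O ≐ ⟦ B ⟧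
  order-as-candidate O-order Λ⊆O = generatorResidues O-order Λ⊆O , generatorResidues∈allCandidates O-order Λ⊆O ,
    O⊆⟦generatorResidues⟧ O-order Λ⊆O , ⟦generatorResidues⟧⊆O O-order Λ⊆O

  IsMaximalCandidate : Candidate → Set
  IsMaximalCandidate B = IsOrderCandidate B × All (λ B′ → IsOrderCandidate B′ → B ≼ B′ → B′ ≼ B) allCandidates

  isMaximalCandidate? : Decidable IsMaximalCandidate
  isMaximalCandidate? B = isOrderCandidate? B ×-dec All.all? (λ B′ → isOrderCandidate? B′ →-dec (B ≼? B′ →-dec B′ ≼? B)) allCandidates

  maximalOrders : List (Gens {m})
  maximalOrders = map candidateGens (filter isMaximalCandidate? allCandidates)

  -- Any order above ⟦ B ⟧ contains Λ, hence is ⟦ B′ ⟧ for some candidate B′.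
  maximalCandidate-isMaximalOrder : ∀ {B} → IsMaximalCandidate B → IsMaximalOrder d ⟦ B ⟧
  maximalCandidate-isMaximalOrder {B} (B-order , B-maximal) = IsOrderCandidate⇒IsOrder {B} B-order , maximal
    where
    maximal : ∀ O′ → IsOrder d O′ → ⟦ B ⟧ ⊆ O′ → O′ ⊆ ⟦ B ⟧
    maximal O′ O′-order ⟦B⟧⊆O′ x x∈O′ = ≼⇒⊆ {B′} {B} B′≼B x (proj₁ O′≐⟦B′⟧ x x∈O′)
      where
      O′-candidate = order-as-candidate O′-order (λ y y∈Λ → ⟦B⟧⊆O′ y (Λ⊆⟦⟧ B y y∈Λ))
      B′ = proj₁ O′-candidate
      O′≐⟦B′⟧ = proj₂ (proj₂ O′-candidate)
      B′≼B : B′ ≼ B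
      B′≼B = All.lookup B-maximal (proj₁ (proj₂ O′-candidate)) (IsOrder⇒IsOrderCandidate {B′} (IsOrder-resp-≐ O′-order O′≐⟦B′⟧))
                                                            (⊆⇒≼ {B} {B′} λ y y∈ → proj₁ O′≐⟦B′⟧ y (⟦B⟧⊆O′ y y∈))

  maximalOrders-sound : ∀ G → G ∈ maximalOrders → IsMaximalOrder d (ZSpan G) × (CliffordOrder ⊆ ZSpan G)
  maximalOrders-sound G G∈ = from-candidate (∈-map⁻ candidateGens G∈)
    where
    from-candidate : ∃ (λ B → B ∈ filter isMaximalCandidate? allCandidates × G ≡ candidateGens B) →
                     IsMaximalOrder d (ZSpan G) × (CliffordOrder ⊆ ZSpan G)
    from-candidate (B , B∈ , refl) = maximalCandidate-isMaximalOrder {B} (proj₂ (∈-filter⁻ isMaximalCandidate? {xs = allCandidates} B∈)) , Λ⊆⟦⟧ B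

  maximalOrders-complete : ∀ O → IsMaximalOrder d O → CliffordOrder ⊆ O → Any (λ G → O ≐ ZSpan G) maximalOrders
  maximalOrders-complete O (O-order , O-maximal) Λ⊆O =
    Any.map (λ { refl → O≐⟦B⟧ }) (∈-map⁺ candidateGens (∈-filter⁺ isMaximalCandidate? B∈ (B-order , B-maximal)))
    where
    O-candidate = order-as-candidate O-order Λ⊆O
    B = proj₁ O-candidate
    B∈ = proj₁ (proj₂ O-candidate)
    O≐⟦B⟧ = proj₂ (proj₂ O-candidate)
    B-order = IsOrder⇒IsOrderCandidate {B} (IsOrder-resp-≐ O-order O≐⟦B⟧)
    B-maximal : All (λ B′ → IsOrderCandidate B′ → B ≼ B′ → B′ ≼ B) allCandidates
    B-maximal = All.tabulate λ {B′} _ B′-order B≼B′ → ⊆⇒≼ {B′} {B} λ x x∈⟦B′⟧ →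
      proj₁ O≐⟦B⟧ x (O-maximal ⟦ B′ ⟧ (IsOrderCandidate⇒IsOrder {B′} B′-order) (λ y y∈O → ≼⇒⊆ {B} {B′} B≼B′ y (proj₁ O≐⟦B⟧ y y∈O)) x x∈⟦B′⟧)

mainTheorem5 : Σ ((m : ℕ) → (d : Vec ℤ m) → Nondegenerate d → List (Gens {m})) λ alg →
  (m : ℕ) → (d : Vec ℤ m) → (nd : Nondegenerate d) →
    ((G : Gens {m}) → G ∈ alg m d nd →
        IsMaximalOrder d (ZSpan G) × (CliffordOrder ⊆ ZSpan G))
    × ((O : Pred {m}) → IsMaximalOrder d O → CliffordOrder ⊆ O →
        Any (λ G → O ≐ ZSpan G) (alg m d nd))
mainTheorem5 = (λ m d nd → Algorithm.maximalOrders d nd) ,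
  λ m d nd → Algorithm.maximalOrders-sound d nd , Algorithm.maximalOrders-complete d nd
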